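{- Let $(d_1,d_2)\in\mathbb{N}^2$. For each $s\in\mathbb{N}$, let $\chi_{d_1,d_2}(s)$ be the number of points $(m,n)\in\mathbb{Z}^2$ for which the conditions $$(m,n)=\sum_{k=1}^s\big(f(-i_k),f(-i_k-1)\big),\quad \sum_{k=1}^s f(i_k-2)\le d_1,\quad \sum_{k=1}^s f(i_k-1)\le d_2$$ admit a solution in integers $0\le i_1\le\dots\le i_s$, and $s$ is maximal with this property. Then $$\chi_{d_1,d_2}(s)=\begin{cases}2\min\{d_1,d_2,s,d_1+d_2-s\}+1 & \text{if } 0\le s\le d_1+d_2,\\ 0 & \text{if } s>d_1+d_2.\end{cases}$$ Equivalently, with $\mathbf d=(d_1,d_2)$, the set $\{\alpha\in E_{\mathbf d}:\ s_{\mathbf d}(\alpha)=s\}$ has exactly this cardinality.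
   Context: $\mathbb{N}=\{0,1,2,\dots\}$. Let $f\colon\mathbb{Z}\to\mathbb{Z}$ be defined by $f(0)=f(1)=1$ and $f(i+2)=f(i+1)+f(i)$ for all $i\in\mathbb{Z}$. Empty sums are $0$. Let $\gamma=(1+\sqrt5)/2$ and $\mathbb{Z}[\gamma]=\mathbb{Z}\oplus\mathbb{Z}\gamma^{ -1}$; one has $\gamma^{ -i}=f(-i)+f(-i-1)\gamma^{ -1}$. For $\mathbf d=(d_1,d_2)\in\mathbb{N}^2$, $E_{\mathbf d}$ denotes the set of $\alpha\in\mathbb{Z}[\gamma]$ such that $\alpha=\sum_{k=1}^s\gamma^{ -i_k}$, $\sum_{k=1}^s f(i_k-2)\le d_1$ and $\sum_{k=1}^s f(i_k-1)\le d_2$ for some $s\in\mathbb{N}$ and integers $0\le i_1\le\dots\le i_s$; for $\alpha\in E_{\mathbf d}$, $s_{\mathbf d}(\alpha)$ is the largest such $s$. -}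

module Defs where

open import Algebra.Bundles.Raw using (RawSemiring)
import Algebra.Definitions.RawMonoid as RawMonoidDefs
import Algebra.Definitions.RawSemiring as RawSemiringDefs
import Data.Fin as Fin
open import Data.Integer using (ℤ; +_; -[1+_]; 0ℤ; 1ℤ; _+_; _-_; _*_; -_; _≤_; +-0-rawMonoid)
open import Data.Integer.Properties using (+-assoc; +-comm; +-inverseʳ; +-identityʳ)
open import Data.List using (length)
open import Data.List.Membership.Propositional using (_∈_)
open import Data.List.Relation.Unary.Unique.Propositional using (Unique)
open import Data.Nat as ℕ using (ℕ; suc)
import Data.Nat.Properties as ℕₚ
open import Data.Product using (_×_; _,_; ∃-syntax)
open import Data.Vec.Functional using (Vector)
open import Function.Bundles using (_⇔_)
open import Level using (Level; 0ℓ; _⊔_)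
open import Relation.Binary.PropositionalEquality using (_≡_; refl; sym; trans; cong)
open import Relation.Unary using (Pred)

private
  variable
    a ℓ : Level

f : ℤ → ℤ
f (+ 0)                = 1ℤ
f (+ 1)                = 1ℤ
f (+ suc (suc n))      = f (+ suc n) + f (+ n)
f -[1+ 0 ]             = 0ℤ
f -[1+ 1 ]             = 1ℤ
f -[1+ suc (suc n) ]   = f -[1+ n ] - f -[1+ suc n ]

-- With f 0 = f 1 = 1, this recurrence over all of ℤ determines f.
f-rec : ∀ i → f (i + + 2) ≡ f (i + + 1) + f i
f-rec (+ n) rewrite ℕₚ.+-comm n 2 | ℕₚ.+-comm n 1 = refl
f-rec -[1+ 0 ] = refl
f-rec -[1+ 1 ] = refl
f-rec -[1+ suc (suc n) ] = sym (cancel (f -[1+ suc n ]) (f -[1+ n ]))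
  where
  cancel : ∀ x y → x + (y - x) ≡ y
  cancel x y = trans (+-comm x (y - x)) (trans (+-assoc y (- x) x)
    (trans (cong (λ z → y + z) (trans (+-comm (- x) x) (+-inverseʳ x))) (+-identityʳ y)))

-- ℤ[γ] = ℤ ⊕ ℤγ⁻¹: the element  m ⊕ n γ⁻¹  stands for m + nγ⁻¹.
record ℤ[γ] : Set where
  constructor _⊕_γ⁻¹
  field
    const coeff : ℤ

-- Multiplication comes from (γ⁻¹)² = 1 - γ⁻¹.
ℤ[γ]-rawSemiring : RawSemiring 0ℓ 0ℓ
ℤ[γ]-rawSemiring = record
  { Carrier = ℤ[γ]
  ; _≈_     = _≡_
  ; _+_     = λ { (m ⊕ n γ⁻¹) (m′ ⊕ n′ γ⁻¹) → (m + m′) ⊕ (n + n′) γ⁻¹ }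
  ; _*_     = λ { (m ⊕ n γ⁻¹) (m′ ⊕ n′ γ⁻¹) →
                    (m * m′ + n * n′) ⊕ (m * n′ + n * m′ - n * n′) γ⁻¹ }
  ; 0#      = 0ℤ ⊕ 0ℤ γ⁻¹
  ; 1#      = 1ℤ ⊕ 0ℤ γ⁻¹
  }

module ℤ[γ]-Ops where
  open RawSemiring ℤ[γ]-rawSemiring public using (_+_; _*_; 0#; 1#)
  open RawSemiringDefs ℤ[γ]-rawSemiring public using (sum; _^_)

module ℤ-Ops where
  open RawMonoidDefs +-0-rawMonoid public using (sum)

γ γ⁻¹ : ℤ[γ]
γ   = 1ℤ ⊕ 1ℤ γ⁻¹
γ⁻¹ = 0ℤ ⊕ 1ℤ γ⁻¹

γ²≡γ+1 : γ ℤ[γ]-Ops.* γ ≡ γ ℤ[γ]-Ops.+ ℤ[γ]-Ops.1#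
γ²≡γ+1 = refl

γγ⁻¹≡1 : γ ℤ[γ]-Ops.* γ⁻¹ ≡ ℤ[γ]-Ops.1#
γγ⁻¹≡1 = refl

γ^_ : ℤ → ℤ[γ]
γ^ (+ n)    = γ ℤ[γ]-Ops.^ n
γ^ -[1+ n ] = γ⁻¹ ℤ[γ]-Ops.^ suc n

-- Integers 0 ≤ i₁ ≤ … ≤ iₛ satisfying the two inequalities given by (d₁ , d₂).
record Admissible (d₁ d₂ : ℕ) {s : ℕ} (i : Vector ℤ s) : Set where
  field
    nonNegative : ∀ k → 0ℤ ≤ i k
    monotone    : ∀ j k → j Fin.≤ k → i j ≤ i k
    bound₁      : ℤ-Ops.sum (λ k → f (i k - + 2)) ≤ + d₁
    bound₂      : ℤ-Ops.sum (λ k → f (i k - + 1)) ≤ + d₂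

PointRep : ℕ → ℕ → ℤ × ℤ → Pred ℕ 0ℓ
PointRep d₁ d₂ p s = ∃[ i ]
  p ≡ (ℤ-Ops.sum {s} (λ k → f (- i k)) , ℤ-Ops.sum {s} (λ k → f (- i k - + 1)))
  × Admissible d₁ d₂ i

γRep : ℕ → ℕ → ℤ[γ] → Pred ℕ 0ℓ
γRep d₁ d₂ α s = ∃[ i ] α ≡ ℤ[γ]-Ops.sum {s} (λ k → γ^ (- i k)) × Admissible d₁ d₂ i

E : ℕ → ℕ → Pred ℤ[γ] 0ℓ
E d₁ d₂ α = ∃[ s ] γRep d₁ d₂ α s

IsLargest : Pred ℕ ℓ → Pred ℕ ℓ
IsLargest P s = P s × (∀ t → P t → t ℕ.≤ s)

-- The relation s_d(α) = s.
s[_,_]_is_ : ℕ → ℕ → ℤ[γ] → ℕ → Set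
s[ d₁ , d₂ ] α is s = IsLargest (γRep d₁ d₂ α) s

HasCardinality : {A : Set a} → Pred A ℓ → ℕ → Set (a ⊔ ℓ)
HasCardinality P n = ∃[ xs ] Unique xs × length xs ≡ n × (∀ x → x ∈ xs ⇔ P x)

{-# OPTIONS --safe #-}
module Submission where

-- Call (Σ f(iₖ - 2) , Σ f(iₖ - 1)) the cost of a sum of powers γ⁻ⁱᵏ. A window is a sum of s terms with
-- exponents in {i, i+1, i+2} for some i. Linear functionals with value ≥ 2 on every term γ⁻ʲ (and its
-- cost), and = 2 for the j in the window, show that a window is the cheapest sum, in both coordinates,
-- among all sums of at least s terms with the same value. Replacing γ⁻ⁱ by γ⁻ⁱ⁻¹ + γ⁻ⁱ⁻² makes a window
-- one term longer; undoing such replacements ends in a window that costs no more than any sum with its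
-- value. Hence s_d(α) = s exactly when α has a window of s terms that fits the bounds while its
-- one-term-longer successor does not. The successor costs as much as the window obtained by
-- 2γ⁻ⁱ ↦ 2γ⁻ⁱ⁻² or, if γ⁻ⁱ occurs once, γ⁻ⁱ ↦ γ⁻ⁱ⁻³. This operation keeps s and arranges the windows of
-- s terms into 2s + 1 chains of increasing cost, so each chain whose first window fits contributes
-- exactly one α. The first windows are a γ⁰ + b γ⁻¹ and a γ⁰ + b γ⁻¹ + γ⁻², and these are counted directly.

open import Defs
import Data.Fin as Fin
open import Data.Integer using (ℤ; +_; -[1+_])
import Data.Integer as ℤ
import Data.Integer.Properties as ℤₚ
import Data.Integer.Tactic.RingSolver as ℤ-Solver
open import Data.List using ([]; _∷_; length; upTo)
open import Data.List.Membership.Propositional using (_∈_)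
open import Data.List.Membership.Propositional.Properties using (∈-upTo⁺; ∈-upTo⁻)
open import Data.List.Properties using (length-upTo)
open import Data.List.Relation.Unary.All as All using (All; []; _∷_)
open import Data.List.Relation.Unary.AllPairs using ([]; _∷_)
open import Data.List.Relation.Unary.Any using (here; there)
open import Data.List.Relation.Unary.Unique.Propositional using (Unique)
open import Data.List.Relation.Unary.Unique.Propositional.Properties using (upTo⁺)
open import Data.Nat using (ℕ; zero; suc; _+_; _*_; _∸_; _⊓_; _≤_; _<_; _>_; z≤n; s≤s)
import Data.Nat.DivMod as DivMod
import Data.Nat.Properties as ℕₚ
import Data.Nat.Tactic.RingSolver as ℕ-Solver
open import Data.Product using (_×_; _,_; ∃-syntax; proj₁; proj₂)
open import Data.Sum using (_⊎_; inj₁; inj₂)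
import Data.Vec.Functional as Vector
open Vector using (Vector)
open import Function using (_∘_)
open import Function.Bundles using (mk⇔; Equivalence)
open import Relation.Binary.Definitions using (Tri; tri<; tri≈; tri>)
open import Relation.Binary.PropositionalEquality
open import Relation.Nullary using (¬_; Dec; yes; no; contradiction)
open import Relation.Nullary.Decidable using (_×-dec_)

-- Values and costs of single powers

-- γ⁻ʲ = val j ⊕ val (1 + j) γ⁻¹, and it contributes (cost j , cost (1 + j)) to the two sums
-- bounded by (d₁ , d₂).
val : ℕ → ℤ
val 0             = + 1
val 1             = + 0
val (suc (suc j)) = val j ℤ.- val (suc j)

cost : ℕ → ℕ
cost 0             = 1
cost 1             = 0
cost (suc (suc j)) = cost j + cost (suc j)

f-neg : ∀ j → f (ℤ.- + j) ≡ val j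
f-neg 0                   = refl
f-neg 1                   = refl
f-neg 2                   = refl
f-neg (suc (suc (suc j))) = cong₂ ℤ._-_ (f-neg (suc j)) (f-neg (suc (suc j)))

f-neg-1 : ∀ j → f (ℤ.- + j ℤ.- + 1) ≡ val (suc j)
f-neg-1 0       = refl
f-neg-1 (suc j) = trans (cong (λ k → f -[1+ suc k ]) (ℕₚ.+-identityʳ j)) (f-neg (suc (suc j)))

f-cost : ∀ j → f (+ j) ≡ + cost (suc (suc j))
f-cost 0             = refl
f-cost 1             = refl
f-cost (suc (suc j)) = trans (cong₂ ℤ._+_ (f-cost (suc j)) (f-cost j))
  (ℤₚ.+-comm (+ cost (suc (suc (suc j)))) (+ cost (suc (suc j))))

f-2 : ∀ j → f (+ j ℤ.- + 2) ≡ + cost j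
f-2 0             = refl
f-2 1             = refl
f-2 (suc (suc j)) = f-cost j

f-1 : ∀ j → f (+ j ℤ.- + 1) ≡ + cost (suc j)
f-1 0       = refl
f-1 (suc j) = f-cost j

val-rec : ∀ j → val (suc j) ℤ.+ val (suc (suc j)) ≡ val j
val-rec j = lemma (val j) (val (suc j))
  where
  lemma : ∀ x y → y ℤ.+ (x ℤ.- y) ≡ x
  lemma = ℤ-Solver.solve-∀

-- `val` is `cost` with alternating signs: its recurrence subtracts terms of opposite sign, so
-- absolute values add as in `cost`.
val-parity : ∀ j → (val j ≡ + cost j × val (suc j) ≡ ℤ.- + cost (suc j))
                 ⊎ (val j ≡ ℤ.- + cost j × val (suc j) ≡ + cost (suc j))
val-parity zero = inj₁ (refl , refl)
val-parity (suc j) with val-parity j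
... | inj₁ (p , q) = inj₂ (q , trans (cong₂ ℤ._-_ p q) (lemma (+ cost j) (+ cost (suc j))))
  where
  lemma : ∀ x y → x ℤ.- (ℤ.- y) ≡ x ℤ.+ y
  lemma = ℤ-Solver.solve-∀
... | inj₂ (p , q) = inj₁ (q , trans (cong₂ ℤ._-_ p q) (lemma (+ cost j) (+ cost (suc j))))
  where
  lemma : ∀ x y → ℤ.- x ℤ.- y ≡ ℤ.- (x ℤ.+ y)
  lemma = ℤ-Solver.solve-∀

-- Linear functionals in value and cost

-- Applied to a value m ⊕ n γ⁻¹ of cost (a , b). Multiplication by γ lowers all exponents by one and
-- takes (m , n , a , b) to (m + n , m , b - a , a).
Φ : ℕ → (m n a b : ℤ) → ℤ
Φ zero    m n a b = + 2 ℤ.* m ℤ.+ n ℤ.+ b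
Φ (suc i) m n a b = Φ i (m ℤ.+ n) m (b ℤ.- a) a

Φ-+ : ∀ i m n a b m′ n′ a′ b′ →
      Φ i (m ℤ.+ m′) (n ℤ.+ n′) (a ℤ.+ a′) (b ℤ.+ b′) ≡ Φ i m n a b ℤ.+ Φ i m′ n′ a′ b′
Φ-+ zero = lemma
  where
  lemma : ∀ m n a b m′ n′ a′ b′ →
          + 2 ℤ.* (m ℤ.+ m′) ℤ.+ (n ℤ.+ n′) ℤ.+ (b ℤ.+ b′)
          ≡ (+ 2 ℤ.* m ℤ.+ n ℤ.+ b) ℤ.+ (+ 2 ℤ.* m′ ℤ.+ n′ ℤ.+ b′)
  lemma = ℤ-Solver.solve-∀
Φ-+ (suc i) m n a b m′ n′ a′ b′ =
  trans (cong₂ (λ x y → Φ i x (m ℤ.+ m′) y (a ℤ.+ a′)) (lemma₁ m n m′ n′) (lemma₂ a b a′ b′))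
        (Φ-+ i _ _ _ _ _ _ _ _)
  where
  lemma₁ : ∀ m n m′ n′ → (m ℤ.+ m′) ℤ.+ (n ℤ.+ n′) ≡ (m ℤ.+ n) ℤ.+ (m′ ℤ.+ n′)
  lemma₁ = ℤ-Solver.solve-∀
  lemma₂ : ∀ a b a′ b′ → (b ℤ.+ b′) ℤ.- (a ℤ.+ a′) ≡ (b ℤ.- a) ℤ.+ (b′ ℤ.- a′)
  lemma₂ = ℤ-Solver.solve-∀

Φ-* : ∀ i x m n a b →
      Φ i (x ℤ.* m) (x ℤ.* n) (x ℤ.* a) (x ℤ.* b) ≡ x ℤ.* Φ i m n a b
Φ-* zero x m n a b = lemma x m n b
  where
  lemma : ∀ x m n b → + 2 ℤ.* (x ℤ.* m) ℤ.+ x ℤ.* n ℤ.+ x ℤ.* b ≡ x ℤ.* (+ 2 ℤ.* m ℤ.+ n ℤ.+ b)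
  lemma = ℤ-Solver.solve-∀
Φ-* (suc i) x m n a b =
  trans (cong₂ (λ y z → Φ i y (x ℤ.* m) z (x ℤ.* a)) (lemma₁ x m n) (lemma₂ x a b))
        (Φ-* i x _ _ _ _)
  where
  lemma₁ : ∀ x m n → x ℤ.* m ℤ.+ x ℤ.* n ≡ x ℤ.* (m ℤ.+ n)
  lemma₁ = ℤ-Solver.solve-∀
  lemma₂ : ∀ x a b → x ℤ.* b ℤ.- x ℤ.* a ≡ x ℤ.* (b ℤ.- a)
  lemma₂ = ℤ-Solver.solve-∀

φ : ℕ → ℕ → ℤ
φ i j = Φ i (val j) (val (suc j)) (+ cost j) (+ cost (suc j))

φ-suc-suc : ∀ i j → φ (suc i) (suc j) ≡ φ i j
φ-suc-suc i j = cong₂ (λ x y → Φ i x (val (suc j)) y (+ cost (suc j))) (val-rec j)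
                      (lemma (+ cost j) (+ cost (suc j)))
  where
  lemma : ∀ x y → x ℤ.+ y ℤ.- y ≡ x
  lemma = ℤ-Solver.solve-∀

-- For `k` from 0 to 3 the right side evaluates to 2. So `Φ i` is tight on four consecutive
-- exponents, hence on windows with base `i` and with base `suc i`.
φ-diag : ∀ i k → φ i (k + i) ≡ φ 0 k
φ-diag zero    k = cong (φ 0) (ℕₚ.+-identityʳ k)
φ-diag (suc i) k = trans (cong (φ (suc i)) (ℕₚ.+-suc k i)) (trans (φ-suc-suc i (k + i)) (φ-diag i k))

cost-pos : ∀ j → 1 ≤ cost (suc (suc j))
cost-pos zero          = s≤s z≤n
cost-pos (suc zero)    = s≤s z≤n
cost-pos (suc (suc j)) = ℕₚ.≤-trans (cost-pos j) (ℕₚ.m≤m+n _ _)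

-- From exponent 3 on, `val-parity` collapses `Φ 0` to twice a single positive Fibonacci number.
2≤φ₀ : ∀ j → + 2 ℤ.≤ φ 0 j
2≤φ₀ 0 = ℤ.+≤+ ℕₚ.≤-refl
2≤φ₀ 1 = ℤ.+≤+ ℕₚ.≤-refl
2≤φ₀ 2 = ℤ.+≤+ ℕₚ.≤-refl
2≤φ₀ (suc (suc (suc j))) with val-parity (suc (suc (suc j)))
... | inj₁ (p , q) rewrite p | q =
  subst (+ 2 ℤ.≤_) (sym (lemma (+ cost (3 + j)) (+ cost (4 + j))))
    (ℤₚ.*-monoˡ-≤-nonNeg (+ 2) (ℤ.+≤+ (cost-pos (suc j))))
  where
  lemma : ∀ x y → + 2 ℤ.* x ℤ.+ ℤ.- y ℤ.+ y ≡ + 2 ℤ.* x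
  lemma = ℤ-Solver.solve-∀
... | inj₂ (p , q) rewrite p | q =
  subst (+ 2 ℤ.≤_) (sym (lemma (+ cost (2 + j)) (+ cost (3 + j))))
    (ℤₚ.*-monoˡ-≤-nonNeg (+ 2) (ℤ.+≤+ (cost-pos j)))
  where
  lemma : ∀ x y → + 2 ℤ.* (ℤ.- y) ℤ.+ (x ℤ.+ y) ℤ.+ (x ℤ.+ y) ≡ + 2 ℤ.* x
  lemma = ℤ-Solver.solve-∀

-- For consecutive Fibonacci numbers m and n, these are the arguments belonging to γᵏ, k even resp. odd.
Φ-γ-even : ∀ i m n → + (2 * m) ℤ.≤ Φ i (+ m) (+ n) (+ m) (ℤ.- + n)
Φ-γ-odd  : ∀ i m n → + (2 * m) ℤ.≤ Φ i (+ m) (+ n) (ℤ.- + m) (+ n)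

Φ-γ-even zero    m n = ℤₚ.≤-reflexive (trans (ℤₚ.pos-* 2 m) (lemma (+ m) (+ n)))
  where
  lemma : ∀ x y → + 2 ℤ.* x ≡ + 2 ℤ.* x ℤ.+ y ℤ.+ ℤ.- y
  lemma = ℤ-Solver.solve-∀
Φ-γ-even (suc i) m n = ℤₚ.≤-trans (ℤ.+≤+ (ℕₚ.*-monoʳ-≤ 2 (ℕₚ.m≤m+n m n)))
  (subst (λ a → + (2 * (m + n)) ℤ.≤ Φ i (+ (m + n)) (+ m) a (+ m)) (lemma (+ m) (+ n))
    (Φ-γ-odd i (m + n) m))
  where
  lemma : ∀ x y → ℤ.- (x ℤ.+ y) ≡ ℤ.- y ℤ.- x
  lemma = ℤ-Solver.solve-∀

Φ-γ-odd zero    m n = subst (λ x → + (2 * m) ℤ.≤ x ℤ.+ + n ℤ.+ + n) (ℤₚ.pos-* 2 m)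
  (ℤ.+≤+ (ℕₚ.≤-trans (ℕₚ.m≤m+n (2 * m) n) (ℕₚ.m≤m+n (2 * m + n) n)))
Φ-γ-odd (suc i) m n = ℤₚ.≤-trans (ℤ.+≤+ (ℕₚ.*-monoʳ-≤ 2 (ℕₚ.m≤m+n m n)))
  (subst (λ a → + (2 * (m + n)) ℤ.≤ Φ i (+ (m + n)) (+ m) a (ℤ.- + m)) (lemma (+ m) (+ n))
    (Φ-γ-even i (m + n) m))
  where
  lemma : ∀ x y → x ℤ.+ y ≡ y ℤ.- (ℤ.- x)
  lemma = ℤ-Solver.solve-∀

-- Lowering both arguments leads to exponent 0, and then to `Φ` on positive powers of γ. The surplus
-- over the tight value 2 is what makes the base of a window unique.
4≤φ : ∀ i j → j < i → + 4 ℤ.≤ φ i j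
4≤φ (suc i) zero    _         = strict i
  where
  strict : ∀ i → + 4 ℤ.≤ Φ i (+ 1) (+ 1) -[1+ 0 ] (+ 1)
  strict zero    = ℤₚ.≤-refl
  strict (suc i) = Φ-γ-even i 2 1
4≤φ (suc i) (suc j) (s≤s j<i) = subst (+ 4 ℤ.≤_) (sym (φ-suc-suc i j)) (4≤φ i j j<i)

2≤φ : ∀ i j → + 2 ℤ.≤ φ i j
2≤φ zero    j       = 2≤φ₀ j
2≤φ (suc i) zero    = ℤₚ.≤-trans (ℤ.+≤+ (s≤s (s≤s z≤n))) (4≤φ (suc i) zero (s≤s z≤n))
2≤φ (suc i) (suc j) = subst (+ 2 ℤ.≤_) (sym (φ-suc-suc i j)) (2≤φ i j)

Φ-0 : ∀ i → Φ i (+ 0) (+ 0) (+ 0) (+ 0) ≡ + 0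
Φ-0 zero    = refl
Φ-0 (suc i) = Φ-0 i

+-cancelˡ-≤ : ∀ k {m n} → k ℤ.+ m ℤ.≤ k ℤ.+ n → m ℤ.≤ n
+-cancelˡ-≤ k {m} {n} p = subst₂ ℤ._≤_ (lemma k m) (lemma k n) (ℤₚ.+-monoʳ-≤ (ℤ.- k) p)
  where
  lemma : ∀ x y → ℤ.- x ℤ.+ (x ℤ.+ y) ≡ y
  lemma = ℤ-Solver.solve-∀

-- For a fixed value, `Φ 0` depends only on `b` and `Φ 1` only on `a`. Multiplication by γ reduces
-- any consecutive pair of functionals to this one, with costs `b - a` and `a`.
Φ-cancel-≤ : ∀ i {m n a b a′ b′} → Φ i m n a b ℤ.≤ Φ i m n a′ b′ →
             Φ (suc i) m n a b ℤ.≤ Φ (suc i) m n a′ b′ → a ℤ.≤ a′ × b ℤ.≤ b′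
Φ-cancel-≤ zero {m} {n} p q =
  +-cancelˡ-≤ (+ 2 ℤ.* (m ℤ.+ n) ℤ.+ m) q , +-cancelˡ-≤ (+ 2 ℤ.* m ℤ.+ n) p
Φ-cancel-≤ (suc i) {a = a} {b} {a′} {b′} p q with Φ-cancel-≤ i p q
... | b-a≤b′-a′ , a≤a′ =
  a≤a′ , subst₂ ℤ._≤_ (lemma a b) (lemma a′ b′) (ℤₚ.+-mono-≤ b-a≤b′-a′ a≤a′)
  where
  lemma : ∀ x y → y ℤ.- x ℤ.+ x ≡ y
  lemma = ℤ-Solver.solve-∀

-- Sums of powers and bounds for their cost

-- Rep s m n a b: m ⊕ n γ⁻¹ is a sum of s powers γ⁻ʲ of total cost (a , b).
data Rep : ℕ → ℤ → ℤ → ℕ → ℕ → Set where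
  []  : Rep 0 (+ 0) (+ 0) 0 0
  _∷_ : ∀ {s m n a b} j → Rep s m n a b →
        Rep (suc s) (val j ℤ.+ m) (val (suc j) ℤ.+ n) (cost j + a) (cost (suc j) + b)

infixr 5 _∷_

Φ-Rep : ∀ i {s m n a b} → Rep s m n a b → + (2 * s) ℤ.≤ Φ i m n (+ a) (+ b)
Φ-Rep i []                           = ℤₚ.≤-reflexive (sym (Φ-0 i))
Φ-Rep i (_∷_ {s} {m} {n} {a} {b} j r) = subst₂ ℤ._≤_
  (cong +_ (sym (ℕₚ.*-suc 2 s))) (sym (Φ-+ i _ _ _ _ m n (+ a) (+ b)))
  (ℤₚ.+-mono-≤ (2≤φ i j) (Φ-Rep i r))

∣val∣≤cost : ∀ j → val j ℤ.≤ + cost j × ℤ.- val j ℤ.≤ + cost j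
∣val∣≤cost j with val-parity j
... | inj₁ (p , _) rewrite p = ℤₚ.≤-refl , ℤₚ.neg-≤-pos
... | inj₂ (p , _) rewrite p = ℤₚ.neg-≤-pos , ℤₚ.≤-reflexive (ℤₚ.neg-involutive (+ cost j))

∣m∣≤a : ∀ {s m n a b} → Rep s m n a b → m ℤ.≤ + a × ℤ.- m ℤ.≤ + a
∣m∣≤a [] = ℤₚ.≤-refl , ℤₚ.≤-refl
∣m∣≤a (_∷_ {m = m} {a = a} j r) =
  ℤₚ.+-mono-≤ (proj₁ (∣val∣≤cost j)) (proj₁ (∣m∣≤a r)) ,
  subst (ℤ._≤ + (cost j + a)) (sym (ℤₚ.neg-distrib-+ (val j) m))
    (ℤₚ.+-mono-≤ (proj₂ (∣val∣≤cost j)) (proj₂ (∣m∣≤a r)))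

∣n∣≤b : ∀ {s m n a b} → Rep s m n a b → n ℤ.≤ + b × ℤ.- n ℤ.≤ + b
∣n∣≤b [] = ℤₚ.≤-refl , ℤₚ.≤-refl
∣n∣≤b (_∷_ {n = n} {b = b} j r) =
  ℤₚ.+-mono-≤ (proj₁ (∣val∣≤cost (suc j))) (proj₁ (∣n∣≤b r)) ,
  subst (ℤ._≤ + (cost (suc j) + b)) (sym (ℤₚ.neg-distrib-+ (val (suc j)) n))
    (ℤₚ.+-mono-≤ (proj₂ (∣val∣≤cost (suc j))) (proj₂ (∣n∣≤b r)))

1≤cost+cost : ∀ j → 1 ≤ cost j + cost (suc j)
1≤cost+cost zero    = s≤s z≤n
1≤cost+cost (suc j) = subst (1 ≤_) (ℕₚ.+-comm (cost j + cost (suc j)) (cost (suc j)))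
  (ℕₚ.≤-trans (1≤cost+cost j) (ℕₚ.m≤m+n _ _))

-- Every term adds at least 1 to the sum of both costs. This yields the case `s > d₁ + d₂`.
size≤total-cost : ∀ {s m n a b} → Rep s m n a b → s ≤ a + b
size≤total-cost []                            = z≤n
size≤total-cost (_∷_ {s} {a = a} {b = b} j r) = subst (suc s ≤_)
  (lemma (cost j) (cost (suc j)) a b) (ℕₚ.+-mono-≤ (1≤cost+cost j) (size≤total-cost r))
  where
  lemma : ∀ x y a b → x + y + (a + b) ≡ x + a + (y + b)
  lemma = ℕ-Solver.solve-∀

-- Windows are cheapest

C : (i a b c : ℕ) → ℕ
C i a b c = a * cost i + b * cost (1 + i) + c * cost (2 + i)

V : (i a b c : ℕ) → ℤ
V i a b c = + a ℤ.* val i ℤ.+ + b ℤ.* val (1 + i) ℤ.+ + c ℤ.* val (2 + i)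

-- The multiset of lo copies of γ⁻ⁱ, mid copies of γ⁻ⁱ⁻¹ and hi copies of γ⁻ⁱ⁻², where i = base.
record Window : Set where
  constructor ⟨_,_,_,_⟩
  field
    base lo mid hi : ℕ

size cost₁ cost₂ : Window → ℕ
size  ⟨ i , a , b , c ⟩ = a + b + c
cost₁ ⟨ i , a , b , c ⟩ = C i a b c
cost₂ ⟨ i , a , b , c ⟩ = C (suc i) a b c

val₁ val₂ : Window → ℤ
val₁ ⟨ i , a , b , c ⟩ = V i a b c
val₂ ⟨ i , a , b , c ⟩ = V (suc i) a b c

+C : ∀ i a b c → + C i a b c ≡ + a ℤ.* + cost i ℤ.+ + b ℤ.* + cost (1 + i) ℤ.+ + c ℤ.* + cost (2 + i)
+C i a b c = cong₂ ℤ._+_ (cong₂ ℤ._+_ (ℤₚ.pos-* a (cost i)) (ℤₚ.pos-* b (cost (1 + i))))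
                         (ℤₚ.pos-* c (cost (2 + i)))

Φ-window : ∀ k i a b c → φ k i ≡ + 2 → φ k (1 + i) ≡ + 2 → φ k (2 + i) ≡ + 2 →
           Φ k (V i a b c) (V (1 + i) a b c) (+ C i a b c) (+ C (1 + i) a b c) ≡ + (2 * (a + b + c))
Φ-window k i a b c p q r = begin
  Φ k (V i a b c) (V (1 + i) a b c) (+ C i a b c) (+ C (1 + i) a b c)
    ≡⟨ cong₂ (Φ k (V i a b c) (V (1 + i) a b c)) (+C i a b c) (+C (1 + i) a b c) ⟩
  Φ k (V i a b c) (V (1 + i) a b c) _ _
    ≡⟨ Φ-+ k _ _ _ _ _ _ _ _ ⟩
  Φ k _ _ _ _ ℤ.+ Φ k _ _ _ _
    ≡⟨ cong₂ ℤ._+_ (trans (Φ-+ k _ _ _ _ _ _ _ _)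
         (cong₂ ℤ._+_ (Φ-* k (+ a) _ _ _ _) (Φ-* k (+ b) _ _ _ _))) (Φ-* k (+ c) _ _ _ _) ⟩
  + a ℤ.* φ k i ℤ.+ + b ℤ.* φ k (1 + i) ℤ.+ + c ℤ.* φ k (2 + i)
    ≡⟨ cong₂ ℤ._+_ (cong₂ ℤ._+_ (cong (+ a ℤ.*_) p) (cong (+ b ℤ.*_) q)) (cong (+ c ℤ.*_) r) ⟩
  + a ℤ.* + 2 ℤ.+ + b ℤ.* + 2 ℤ.+ + c ℤ.* + 2
    ≡⟨ lemma (+ a) (+ b) (+ c) ⟩
  + 2 ℤ.* + (a + b + c)
    ≡⟨ ℤₚ.pos-* 2 (a + b + c) ⟨
  + (2 * (a + b + c)) ∎
  where
  open ≡-Reasoning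
  lemma : ∀ x y z → x ℤ.* + 2 ℤ.+ y ℤ.* + 2 ℤ.+ z ℤ.* + 2 ≡ + 2 ℤ.* (x ℤ.+ y ℤ.+ z)
  lemma = ℤ-Solver.solve-∀

Φ-Window-base : ∀ q → let i = Window.base q in
                Φ i (val₁ q) (val₂ q) (+ cost₁ q) (+ cost₂ q) ≡ + (2 * size q)
Φ-Window-base ⟨ i , a , b , c ⟩ = Φ-window i i a b c (φ-diag i 0) (φ-diag i 1) (φ-diag i 2)

Φ-Window-pred : ∀ i a b c → let q = ⟨ suc i , a , b , c ⟩ in
                Φ i (val₁ q) (val₂ q) (+ cost₁ q) (+ cost₂ q) ≡ + (2 * size q)
Φ-Window-pred i a b c = Φ-window i (suc i) a b c (φ-diag i 1) (φ-diag i 2) (φ-diag i 3)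

-- On a window with base `suc i` both `Φ i` and `Φ (suc i)` are tight, while on the other sum they
-- are at least `2 * t`. The values agree, so `Φ-cancel-≤` compares the costs.
window-minimal : ∀ q {t m n a b} → Rep t m n a b → m ≡ val₁ q → n ≡ val₂ q → size q ≤ t →
                 cost₁ q ≤ a × cost₂ q ≤ b
-- No functional precedes `Φ 0`. Instead, `val` and `cost` agree at 0, 1 and 2, so the first cost of
-- the window is `m` itself.
window-minimal q@(⟨ zero , x , y , z ⟩) {t} {a = a} {b} r refl refl s≤t =
  ℤₚ.drop‿+≤+ (subst (ℤ._≤ + a) (sym (+C 0 x y z)) (proj₁ (∣m∣≤a r))) ,
  ℤₚ.drop‿+≤+ (+-cancelˡ-≤ (+ 2 ℤ.* val₁ q ℤ.+ val₂ q)
    (ℤₚ.≤-trans (ℤₚ.≤-reflexive (Φ-Window-base q))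
      (ℤₚ.≤-trans (ℤ.+≤+ (ℕₚ.*-monoʳ-≤ 2 s≤t)) (Φ-Rep 0 r))))
window-minimal q@(⟨ suc i , x , y , z ⟩) {t} {a = a} {b} r refl refl s≤t =
  let p₁ , p₂ = Φ-cancel-≤ i
        (ℤₚ.≤-trans (ℤₚ.≤-reflexive (Φ-Window-pred i x y z)) (ℤₚ.≤-trans 2s≤2t (Φ-Rep i r)))
        (ℤₚ.≤-trans (ℤₚ.≤-reflexive (Φ-Window-base q)) (ℤₚ.≤-trans 2s≤2t (Φ-Rep (suc i) r)))
  in ℤₚ.drop‿+≤+ p₁ , ℤₚ.drop‿+≤+ p₂
  where
  2s≤2t : + (2 * size q) ℤ.≤ + (2 * t)
  2s≤2t = ℤ.+≤+ (ℕₚ.*-monoʳ-≤ 2 s≤t)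

-- Ordered exponent vectors

Rep-resp : ∀ {s s′ m m′ n n′ a a′ b b′} → s ≡ s′ → m ≡ m′ → n ≡ n′ → a ≡ a′ → b ≡ b′ →
           Rep s m n a b → Rep s′ m′ n′ a′ b′
Rep-resp refl refl refl refl refl r = r

vector⇒Rep : ∀ {s} (i : Vector ℤ s) → (∀ k → + 0 ℤ.≤ i k) → ∃[ a ] ∃[ b ]
  Rep s (ℤ-Ops.sum (λ k → f (ℤ.- i k))) (ℤ-Ops.sum (λ k → f (ℤ.- i k ℤ.- + 1))) a b ×
  ℤ-Ops.sum (λ k → f (i k ℤ.- + 2)) ≡ + a × ℤ-Ops.sum (λ k → f (i k ℤ.- + 1)) ≡ + b
vector⇒Rep {zero}  i 0≤i = 0 , 0 , [] , refl , refl
vector⇒Rep {suc s} i 0≤i with i Fin.zero | 0≤i Fin.zero | vector⇒Rep (i ∘ Fin.suc) (0≤i ∘ Fin.suc)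
... | + j | _ | a , b , r , p , q =
  cost j + a , cost (suc j) + b ,
  Rep-resp refl (cong (ℤ._+ _) (sym (f-neg j))) (cong (ℤ._+ _) (sym (f-neg-1 j))) refl refl (j ∷ r) ,
  cong₂ ℤ._+_ (f-2 j) p , cong₂ ℤ._+_ (f-1 j) q

-- The bound `l` is carried along so that an exponent `l` can be put in front without breaking
-- monotonicity.
record OrderedRep (l s : ℕ) (m n : ℤ) (a b : ℕ) : Set where
  field
    index       : Vector ℤ s
    lower-bound : ∀ k → + l ℤ.≤ index k
    monotone    : ∀ j k → j Fin.≤ k → index j ℤ.≤ index k
    sum-m       : m ≡ ℤ-Ops.sum (λ k → f (ℤ.- index k))
    sum-n       : n ≡ ℤ-Ops.sum (λ k → f (ℤ.- index k ℤ.- + 1))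
    sum-a       : ℤ-Ops.sum (λ k → f (index k ℤ.- + 2)) ≡ + a
    sum-b       : ℤ-Ops.sum (λ k → f (index k ℤ.- + 1)) ≡ + b

OrderedRep-resp : ∀ {l s s′ m m′ n n′ a a′ b b′} →
                  s ≡ s′ → m ≡ m′ → n ≡ n′ → a ≡ a′ → b ≡ b′ →
                  OrderedRep l s m n a b → OrderedRep l s′ m′ n′ a′ b′
OrderedRep-resp refl refl refl refl refl r = r

ordered-[] : ∀ {l} → OrderedRep l 0 (+ 0) (+ 0) 0 0
ordered-[] = record
  { index = λ () ; lower-bound = λ () ; monotone = λ ()
  ; sum-m = refl ; sum-n = refl ; sum-a = refl ; sum-b = refl }

ordered-∷ : ∀ {s m n a b} l → OrderedRep l s m n a b →
            OrderedRep l (suc s) (val l ℤ.+ m) (val (suc l) ℤ.+ n) (cost l + a) (cost (suc l) + b)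
ordered-∷ l r = record
  { index       = + l Vector.∷ index
  ; lower-bound = λ { Fin.zero → ℤₚ.≤-refl ; (Fin.suc k) → lower-bound k }
  ; monotone    = λ { Fin.zero    Fin.zero    _         → ℤₚ.≤-refl
                    ; Fin.zero    (Fin.suc k) _         → lower-bound k
                    ; (Fin.suc j) (Fin.suc k) (s≤s j≤k) → monotone j k j≤k }
  ; sum-m       = cong₂ ℤ._+_ (sym (f-neg l)) sum-m
  ; sum-n       = cong₂ ℤ._+_ (sym (f-neg-1 l)) sum-n
  ; sum-a       = cong₂ ℤ._+_ (f-2 l) sum-a
  ; sum-b       = cong₂ ℤ._+_ (f-1 l) sum-b
  }
  where open OrderedRep r

ordered-weaken : ∀ {l s m n a b} → OrderedRep (suc l) s m n a b → OrderedRep l s m n a b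
ordered-weaken {l} r = record
  { OrderedRep r
  ; lower-bound = λ k → ℤₚ.≤-trans (ℤ.+≤+ (ℕₚ.n≤1+n l)) (OrderedRep.lower-bound r k) }

ordered-replicate : ∀ l k {s m n a b} → OrderedRep l s m n a b →
  OrderedRep l (k + s) (+ k ℤ.* val l ℤ.+ m) (+ k ℤ.* val (suc l) ℤ.+ n)
               (k * cost l + a) (k * cost (suc l) + b)
ordered-replicate l zero {m = m} {n} r =
  OrderedRep-resp refl (sym (ℤₚ.+-identityˡ m)) (sym (ℤₚ.+-identityˡ n)) refl refl r
ordered-replicate l (suc k) {m = m} {n} {a} {b} r =
  OrderedRep-resp refl (lemma (+ k) (val l) m) (lemma (+ k) (val (suc l)) n)
    (sym (ℕₚ.+-assoc (cost l) (k * cost l) a)) (sym (ℕₚ.+-assoc (cost (suc l)) (k * cost (suc l)) b))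
    (ordered-∷ l (ordered-replicate l k r))
  where
  lemma : ∀ k x m → x ℤ.+ (k ℤ.* x ℤ.+ m) ≡ (+ 1 ℤ.+ k) ℤ.* x ℤ.+ m
  lemma = ℤ-Solver.solve-∀

window-ordered : ∀ i a b c → OrderedRep i (a + b + c) (V i a b c) (V (1 + i) a b c)
                                        (C i a b c) (C (1 + i) a b c)
window-ordered i a b c = OrderedRep-resp (assocℕ a b c)
  (assocℤ (+ a ℤ.* val i) _ _) (assocℤ (+ a ℤ.* val (1 + i)) _ _)
  (assocℕ (a * cost i) _ _) (assocℕ (a * cost (1 + i)) _ _)
  (ordered-replicate i a (ordered-weaken
    (ordered-replicate (1 + i) b (ordered-weaken
      (ordered-replicate (2 + i) c ordered-[])))))
  where
  assocℕ : ∀ x y z → x + (y + (z + 0)) ≡ x + y + z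
  assocℕ = ℕ-Solver.solve-∀
  assocℤ : ∀ x y z → x ℤ.+ (y ℤ.+ (z ℤ.+ + 0)) ≡ x ℤ.+ y ℤ.+ z
  assocℤ = ℤ-Solver.solve-∀

-- Uniqueness of windows

V-rec : ∀ i a b c → V (1 + i) a b c ℤ.+ V (2 + i) a b c ≡ V i a b c
V-rec i a b c = lemma (+ a) (+ b) (+ c) (val i) (val (1 + i)) 
  where
  lemma : ∀ a b c x y →
          (a ℤ.* y ℤ.+ b ℤ.* (x ℤ.- y) ℤ.+ c ℤ.* (y ℤ.- (x ℤ.- y))) ℤ.+
          (a ℤ.* (x ℤ.- y) ℤ.+ b ℤ.* (y ℤ.- (x ℤ.- y)) ℤ.+ c ℤ.* ((x ℤ.- y) ℤ.- (y ℤ.- (x ℤ.- y))))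
          ≡ a ℤ.* x ℤ.+ b ℤ.* y ℤ.+ c ℤ.* (x ℤ.- y)
  lemma = ℤ-Solver.solve-∀

C-rec : ∀ i a b c → C (2 + i) a b c ≡ C i a b c + C (1 + i) a b c
C-rec i a b c = lemma a b c (cost i) (cost (1 + i))
  where
  lemma : ∀ a b c x y →
          a * (x + y) + b * (y + (x + y)) + c * (x + y + (y + (x + y)))
          ≡ a * x + b * y + c * (x + y) + (a * y + b * (x + y) + c * (y + (x + y)))
  lemma = ℕ-Solver.solve-∀

window⇒Rep : ∀ q → Rep (size q) (val₁ q) (val₂ q) (cost₁ q) (cost₂ q)
window⇒Rep ⟨ i , a , b , c ⟩ with window-ordered i a b c
... | r with vector⇒Rep (OrderedRep.index r) (λ k → ℤₚ.≤-trans (ℤ.+≤+ z≤n) (OrderedRep.lower-bound r k))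
...   | _ , _ , r′ , p , q = Rep-resp refl (sym sum-m) (sym sum-n)
          (ℤₚ.+-injective (trans (sym p) sum-a)) (ℤₚ.+-injective (trans (sym q) sum-b)) r′
  where open OrderedRep r

-- At base 0 the costs are `a + c` and `b + c`, which together with the size determine all three
-- entries. `C-rec` recovers the preceding cost and so reduces every base to 0.
cost-injective : ∀ i {a b c a′ b′ c′} → C i a b c ≡ C i a′ b′ c′ → C (1 + i) a b c ≡ C (1 + i) a′ b′ c′ →
                 a + b + c ≡ a′ + b′ + c′ → a ≡ a′ × b ≡ b′ × c ≡ c′
cost-injective zero {a} {b} {c} {a′} {b′} {c′} p q r =
  ℕₚ.+-cancelʳ-≡ c a a′ (trans a+c≡ (cong (_+_ a′) (sym c≡))) , b≡ , c≡
  where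
  lemma₁ : ∀ a b c → a * 1 + b * 0 + c * 1 ≡ a + c
  lemma₁ = ℕ-Solver.solve-∀
  lemma₂ : ∀ a b c → a * 0 + b * 1 + c * 1 ≡ b + c
  lemma₂ = ℕ-Solver.solve-∀
  lemma₃ : ∀ a b c → a + c + b ≡ a + b + c
  lemma₃ = ℕ-Solver.solve-∀
  a+c≡ : a + c ≡ a′ + c′
  a+c≡ = trans (sym (lemma₁ a b c)) (trans p (lemma₁ a′ b′ c′))
  b+c≡ : b + c ≡ b′ + c′
  b+c≡ = trans (sym (lemma₂ a b c)) (trans q (lemma₂ a′ b′ c′))
  b≡ : b ≡ b′
  b≡ = ℕₚ.+-cancelˡ-≡ (a + c) b b′
    (trans (lemma₃ a b c) (trans r (trans (sym (lemma₃ a′ b′ c′)) (cong (_+ b′) (sym a+c≡)))))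
  c≡ : c ≡ c′
  c≡ = ℕₚ.+-cancelˡ-≡ b c c′ (trans b+c≡ (cong (_+ c′) (sym b≡)))
cost-injective (suc i) {a} {b} {c} {a′} {b′} {c′} p q r =
  cost-injective i (ℕₚ.+-cancelʳ-≡ (C (1 + i) a b c) _ _
    (trans (sym (C-rec i a b c)) (trans q (trans (C-rec i a′ b′ c′) (cong (_+_ (C i a′ b′ c′)) (sym p)))))) p r

-- If `i` lay below the base of `q`, the functional at that base would be 2 on each term of `q` but
-- at least 4 on γ⁻ⁱ. The totals would differ although value, cost and size agree.
window-base-≮ : ∀ i a b c q → size ⟨ i , suc a , b , c ⟩ ≡ size q →
  val₁ ⟨ i , suc a , b , c ⟩ ≡ val₁ q → val₂ ⟨ i , suc a , b , c ⟩ ≡ val₂ q →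
  cost₁ ⟨ i , suc a , b , c ⟩ ≡ cost₁ q → cost₂ ⟨ i , suc a , b , c ⟩ ≡ cost₂ q →
  ¬ i < Window.base q
window-base-≮ i a b c q s≡ m≡ n≡ a≡ b≡ i<j = ℤₚ.<-irrefl {x = + (2 * size q)} refl (ℤₚ.<-≤-trans
  (ℤₚ.<-≤-trans
    (subst (λ s → + (2 * s) ℤ.< + 4 ℤ.+ + (2 * (a + b + c))) s≡
      (subst (λ s → + s ℤ.< + 4 ℤ.+ + (2 * (a + b + c))) (sym (ℕₚ.*-suc 2 (a + b + c)))
         (ℤ.+<+ (s≤s (s≤s (s≤s (ℕₚ.n≤1+n _)))))))
    (ℤₚ.+-mono-≤ (4≤φ j i i<j) (Φ-Rep j (window⇒Rep ⟨ i , a , b , c ⟩))))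
  (ℤₚ.≤-reflexive (begin
    φ j i ℤ.+ Φ j (val₁ q₀) (val₂ q₀) (+ cost₁ q₀) (+ cost₂ q₀)
      ≡⟨ Φ-+ j _ _ _ _ _ _ _ _ ⟨
    Φ j (val i ℤ.+ val₁ q₀) (val (1 + i) ℤ.+ val₂ q₀) (+ (cost i + cost₁ q₀)) (+ (cost (1 + i) + cost₂ q₀))
      ≡⟨ cong₂ (λ x y → Φ j x y (+ (cost i + cost₁ q₀)) (+ (cost (1 + i) + cost₂ q₀)))
           (trans (lemmaℤ (+ a) (+ b) (+ c) (val i) _ _) m≡)
           (trans (lemmaℤ (+ a) (+ b) (+ c) (val (1 + i)) _ _) n≡) ⟩
    Φ j (val₁ q) (val₂ q) (+ (cost i + cost₁ q₀)) (+ (cost (1 + i) + cost₂ q₀))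
      ≡⟨ cong₂ (λ x y → Φ j (val₁ q) (val₂ q) (+ x) (+ y))
           (trans (lemmaℕ a b c (cost i) _ _) a≡)
           (trans (lemmaℕ a b c (cost (1 + i)) _ _) b≡) ⟩
    Φ j (val₁ q) (val₂ q) (+ cost₁ q) (+ cost₂ q)
      ≡⟨ Φ-Window-base q ⟩
    + (2 * size q) ∎)))
  where
  open ≡-Reasoning
  j = Window.base q
  q₀ = ⟨ i , a , b , c ⟩
  lemmaℤ : ∀ a b c x y z → x ℤ.+ (a ℤ.* x ℤ.+ b ℤ.* y ℤ.+ c ℤ.* z) ≡ (+ 1 ℤ.+ a) ℤ.* x ℤ.+ b ℤ.* y ℤ.+ c ℤ.* z
  lemmaℤ = ℤ-Solver.solve-∀
  lemmaℕ : ∀ a b c x y z → x + (a * x + b * y + c * z) ≡ suc a * x + b * y + c * z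
  lemmaℕ = ℕ-Solver.solve-∀

window-cost-≡ : ∀ q q′ → size q ≡ size q′ → val₁ q ≡ val₁ q′ → val₂ q ≡ val₂ q′ →
                cost₁ q ≡ cost₁ q′ × cost₂ q ≡ cost₂ q′
window-cost-≡ q q′ s≡ m≡ n≡ =
  let p₁ , p₂ = window-minimal q (window⇒Rep q′) (sym m≡) (sym n≡) (ℕₚ.≤-reflexive s≡)
      r₁ , r₂ = window-minimal q′ (window⇒Rep q) m≡ n≡ (ℕₚ.≤-reflexive (sym s≡))
  in ℕₚ.≤-antisym p₁ r₁ , ℕₚ.≤-antisym p₂ r₂

-- A nonzero `lo` fixes the base, since `⟨ i , 0 , b , c ⟩` and `⟨ suc i , b , c , 0 ⟩` are the same
-- sum. The costs agree by minimality in both directions.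
window-unique : ∀ i a b c i′ a′ b′ c′ → let q = ⟨ i , suc a , b , c ⟩; q′ = ⟨ i′ , suc a′ , b′ , c′ ⟩ in
  size q ≡ size q′ → val₁ q ≡ val₁ q′ → val₂ q ≡ val₂ q′ → q ≡ q′
window-unique i a b c i′ a′ b′ c′ s≡ m≡ n≡ = helper (ℕₚ.<-cmp i i′)
  where
  q q′ : Window
  q  = ⟨ i , suc a , b , c ⟩
  q′ = ⟨ i′ , suc a′ , b′ , c′ ⟩
  a≡ : cost₁ q ≡ cost₁ q′
  a≡ = proj₁ (window-cost-≡ q q′ s≡ m≡ n≡)
  b≡ : cost₂ q ≡ cost₂ q′
  b≡ = proj₂ (window-cost-≡ q q′ s≡ m≡ n≡)
  same-base : i ≡ i′ → q ≡ q′
  same-base refl =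
    let p₁ , p₂ , p₃ = cost-injective i a≡ b≡ s≡
    in cong₂ (λ x y → ⟨ i , x , proj₁ y , proj₂ y ⟩) p₁ (cong₂ _,_ p₂ p₃)
  helper : Tri (i < i′) (i ≡ i′) (i′ < i) → q ≡ q′
  helper (tri< i<i′ _ _) = contradiction i<i′ (window-base-≮ i a b c q′ s≡ m≡ n≡ a≡ b≡)
  helper (tri> _ _ i′<i) =
    contradiction i′<i (window-base-≮ i′ a′ b′ c′ q (sym s≡) (sym m≡) (sym n≡) (sym a≡) (sym b≡))
  helper (tri≈ _ i≡i′ _) = same-base i≡i′

-- Windows dominating a given sum

next : (i a b c : ℕ) → Window
next i a b c = ⟨ i , a , suc b , suc c ⟩

size-next : ∀ i a b c → size (next i a b c) ≡ suc (size ⟨ i , suc a , b , c ⟩)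
size-next i a b c = lemma a b c
  where
  lemma : ∀ a b c → a + suc b + suc c ≡ suc (suc a + b + c)
  lemma = ℕ-Solver.solve-∀

V-next : ∀ i a b c → V i a (suc b) (suc c) ≡ V i (suc a) b c
V-next i a b c = lemma (+ a) (+ b) (+ c) (val i) (val (1 + i))
  where
  lemma : ∀ a b c x y → a ℤ.* x ℤ.+ (+ 1 ℤ.+ b) ℤ.* y ℤ.+ (+ 1 ℤ.+ c) ℤ.* (x ℤ.- y)
                        ≡ (+ 1 ℤ.+ a) ℤ.* x ℤ.+ b ℤ.* y ℤ.+ c ℤ.* (x ℤ.- y)
  lemma = ℤ-Solver.solve-∀

V-shift : ∀ i a b → V (suc i) a b 0 ≡ V i 0 a b
V-shift i a b = lemma (+ a) (+ b) (val (1 + i)) (val (2 + i)) (val (3 + i)) (val i)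
  where
  lemma : ∀ a b x y z w → a ℤ.* x ℤ.+ b ℤ.* y ℤ.+ + 0 ℤ.* z ≡ + 0 ℤ.* w ℤ.+ a ℤ.* x ℤ.+ b ℤ.* y
  lemma = ℤ-Solver.solve-∀

C-shift : ∀ i a b → C (suc i) a b 0 ≡ C i 0 a b
C-shift i a b = lemma a b (cost (1 + i)) (cost (2 + i)) (cost (3 + i)) (cost i)
  where
  lemma : ∀ a b x y z w → a * x + b * y + 0 * z ≡ 0 * w + a * x + b * y
  lemma = ℕ-Solver.solve-∀

-- Up to sign, no cancellation takes place among powers of equal parity.
V-sparse : ∀ i a c → V i a 0 c ≡ + C i a 0 c ⊎ V i a 0 c ≡ ℤ.- + C i a 0 c
V-sparse i a c with val-parity i
... | inj₁ (p , q) = inj₁ (trans (cong₂ (V′ (+ a) (+ c)) p q)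
                              (trans (lemma (+ a) (+ c) (+ cost i) (+ cost (1 + i))) (sym (+C i a 0 c))))
  where
  V′ : ℤ → ℤ → ℤ → ℤ → ℤ
  V′ a c x y = a ℤ.* x ℤ.+ + 0 ℤ.* y ℤ.+ c ℤ.* (x ℤ.- y)
  lemma : ∀ a c x y → a ℤ.* x ℤ.+ + 0 ℤ.* (ℤ.- y) ℤ.+ c ℤ.* (x ℤ.- (ℤ.- y))
                      ≡ a ℤ.* x ℤ.+ + 0 ℤ.* y ℤ.+ c ℤ.* (x ℤ.+ y)
  lemma = ℤ-Solver.solve-∀
... | inj₂ (p , q) = inj₂ (trans (cong₂ (V′ (+ a) (+ c)) p q)
                              (trans (lemma (+ a) (+ c) (+ cost i) (+ cost (1 + i))) (cong ℤ.-_ (sym (+C i a 0 c)))))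
  where
  V′ : ℤ → ℤ → ℤ → ℤ → ℤ
  V′ a c x y = a ℤ.* x ℤ.+ + 0 ℤ.* y ℤ.+ c ℤ.* (x ℤ.- y)
  lemma : ∀ a c x y → a ℤ.* (ℤ.- x) ℤ.+ + 0 ℤ.* y ℤ.+ c ℤ.* (ℤ.- x ℤ.- y)
                      ≡ ℤ.- (a ℤ.* x ℤ.+ + 0 ℤ.* y ℤ.+ c ℤ.* (x ℤ.+ y))
  lemma = ℤ-Solver.solve-∀

C≤-of-V : ∀ i a c {x} → V i a 0 c ℤ.≤ + x × ℤ.- V i a 0 c ℤ.≤ + x → C i a 0 c ≤ x
C≤-of-V i a c {x} (p , q) with V-sparse i a c
... | inj₁ e = ℤₚ.drop‿+≤+ (subst (ℤ._≤ + x) e p)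
... | inj₂ e = ℤₚ.drop‿+≤+ (subst (ℤ._≤ + x) (trans (cong ℤ.-_ e) (ℤₚ.neg-involutive _)) q)

DominatingWindow : ℕ → ℤ → ℤ → ℕ → ℕ → Set
DominatingWindow t m n x y = ∃[ q ] m ≡ val₁ q × n ≡ val₂ q × t ≤ size q × cost₁ q ≤ x × cost₂ q ≤ y

-- The window is made smaller until it has t terms, where window-minimal applies, or until its cost
-- is (|m| , |n|), which no sum with this value can undercut.
descend : ∀ {t m n x y} → Rep t m n x y → ∀ i a b c → m ≡ V i a b c → n ≡ V (suc i) a b c →
          t ≤ a + b + c → DominatingWindow t m n x y
descend {t} {m} {n} {x} {y} r = go
  where
  go : ∀ i a b c → m ≡ V i a b c → n ≡ V (suc i) a b c → t ≤ a + b + c → DominatingWindow t m n x y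
  go i a zero (suc c) m≡ n≡ t≤ =
    ⟨ i , a , 0 , suc c ⟩ , m≡ , n≡ , t≤ ,
    C≤-of-V i a (suc c) (subst (λ z → z ℤ.≤ + x × ℤ.- z ℤ.≤ + x) m≡ (∣m∣≤a r)) ,
    C≤-of-V (suc i) a (suc c) (subst (λ z → z ℤ.≤ + y × ℤ.- z ℤ.≤ + y) n≡ (∣n∣≤b r))
  go i a (suc b) (suc c) m≡ n≡ t≤ with t ℕₚ.≟ a + suc b + suc c
  ... | yes t≡ = ⟨ i , a , suc b , suc c ⟩ , m≡ , n≡ , t≤ ,
                 window-minimal ⟨ i , a , suc b , suc c ⟩ r m≡ n≡ (ℕₚ.≤-reflexive (sym t≡))
  ... | no  t≢ = go i (suc a) b c (trans m≡ (V-next i a b c)) (trans n≡ (V-next (suc i) a b c))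
                 (ℕₚ.≤-pred (subst (t <_) (size-next i a b c) (ℕₚ.≤∧≢⇒< t≤ t≢)))
  go zero    a b zero m≡ n≡ t≤ = ⟨ 0 , a , b , 0 ⟩ , m≡ , n≡ , t≤ ,
    ℤₚ.drop‿+≤+ (subst (ℤ._≤ + x) (trans m≡ (sym (+C 0 a b 0))) (proj₁ (∣m∣≤a r))) ,
    ℤₚ.drop‿+≤+ (subst (ℤ._≤ + y) (trans n≡ (trans (lemma (+ a) (+ b)) (sym (+C 1 a b 0)))) (proj₁ (∣n∣≤b r)))
    where
    lemma : ∀ a b → a ℤ.* + 0 ℤ.+ b ℤ.* + 1 ℤ.+ + 0 ℤ.* -[1+ 0 ] ≡ a ℤ.* + 0 ℤ.+ b ℤ.* + 1 ℤ.+ + 0 ℤ.* + 1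
    lemma = ℤ-Solver.solve-∀
  -- An empty top slot lets the base drop by one, which may make further contractions possible.
  go (suc i) a b zero m≡ n≡ t≤ = go i 0 a b (trans m≡ (V-shift i a b)) (trans n≡ (V-shift (suc i) a b))
    (subst (t ≤_) (ℕₚ.+-identityʳ (a + b)) t≤)

-- Each γ⁻ⁱ is split into γ⁻ⁱ⁻¹ + γ⁻ⁱ⁻², which only adds terms.
V-raise : ∀ i a b → V (suc i) (a + b) a 0 ≡ V i a b 0
V-raise i a b = lemma (+ a) (+ b) (val i) (val (1 + i)) (val (3 + i))
  where
  lemma : ∀ a b x y z → (a ℤ.+ b) ℤ.* y ℤ.+ a ℤ.* (x ℤ.- y) ℤ.+ + 0 ℤ.* z
                        ≡ a ℤ.* x ℤ.+ b ℤ.* y ℤ.+ + 0 ℤ.* (x ℤ.- y)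
  lemma = ℤ-Solver.solve-∀

raise : ∀ k i a b → ∃[ a′ ] ∃[ b′ ]
        V i a b 0 ≡ V (k + i) a′ b′ 0 × V (1 + i) a b 0 ≡ V (1 + (k + i)) a′ b′ 0 × a + b ≤ a′ + b′
raise zero    i a b = a , b , refl , refl , ℕₚ.≤-refl
raise (suc k) i a b =
  let a′ , b′ , p , q , r = raise k i a b in
  a′ + b′ , a′ , trans p (sym (V-raise (k + i) a′ b′)) , trans q (sym (V-raise (suc (k + i)) a′ b′)) ,
  ℕₚ.≤-trans r (ℕₚ.m≤m+n (a′ + b′) a′)

V-+ : ∀ i a b c a′ b′ c′ → V i a b c ℤ.+ V i a′ b′ c′ ≡ V i (a + a′) (b + b′) (c + c′)
V-+ i a b c a′ b′ c′ = lemma (+ a) (+ b) (+ c) (+ a′) (+ b′) (+ c′) (val i) (val (1 + i)) (val (2 + i))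
  where
  lemma : ∀ a b c a′ b′ c′ x y z → (a ℤ.* x ℤ.+ b ℤ.* y ℤ.+ c ℤ.* z) ℤ.+ (a′ ℤ.* x ℤ.+ b′ ℤ.* y ℤ.+ c′ ℤ.* z)
                                   ≡ (a ℤ.+ a′) ℤ.* x ℤ.+ (b ℤ.+ b′) ℤ.* y ℤ.+ (c ℤ.+ c′) ℤ.* z
  lemma = ℤ-Solver.solve-∀

val-V : ∀ j → val j ≡ V j 1 0 0
val-V j = lemma (val j) (val (1 + j)) (val (2 + j))
  where
  lemma : ∀ x y z → x ≡ + 1 ℤ.* x ℤ.+ + 0 ℤ.* y ℤ.+ + 0 ℤ.* z
  lemma = ℤ-Solver.solve-∀

-- The new term and the rest are both raised to base `i + j` and added there. This supplies the long
-- window from which `descend` starts.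
ladder : ∀ {t m n x y} → Rep t m n x y → ∃[ i ] ∃[ a ] ∃[ b ]
         m ≡ V i a b 0 × n ≡ V (suc i) a b 0 × t ≤ a + b
ladder []      = 0 , 0 , 0 , refl , refl , z≤n
ladder (_∷_ {s} j r) with ladder r
... | i , a , b , m≡ , n≡ , t≤ with raise j i a b | raise i j 1 0
...   | a′ , b′ , p , q , ab≤ | a″ , b″ , p′ , q′ , 1≤ rewrite ℕₚ.+-comm j i =
  i + j , a″ + a′ , b″ + b′ ,
  trans (cong₂ ℤ._+_ (trans (val-V j) p′) (trans m≡ p)) (V-+ (i + j) a″ b″ 0 a′ b′ 0) ,
  trans (cong₂ ℤ._+_ (trans (val-V (suc j)) q′) (trans n≡ q)) (V-+ (suc (i + j)) a″ b″ 0 a′ b′ 0) ,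
  subst (suc s ≤_) (lemma a″ b″ a′ b′) (ℕₚ.+-mono-≤ 1≤ (ℕₚ.≤-trans t≤ ab≤))
  where
  lemma : ∀ x y z w → x + y + (z + w) ≡ x + z + (y + w)
  lemma = ℕ-Solver.solve-∀

dominating-window : ∀ {t m n x y} → Rep t m n x y → DominatingWindow t m n x y
dominating-window {t} r with ladder r
... | i , a , b , m≡ , n≡ , t≤ = descend r i a b 0 m≡ n≡ (subst (t ≤_) (sym (ℕₚ.+-identityʳ (a + b))) t≤)

-- `V-rec` carries the vanishing down to base 0, where the coordinates are `a` and `b`.
V-zero : ∀ i a b → + 0 ≡ V i a b 0 → + 0 ≡ V (1 + i) a b 0 → a + b ≡ 0
V-zero zero a b p q = cong₂ _+_
  (ℤₚ.+-injective (sym (trans p (lemma₁ (+ a) (+ b))))) (ℤₚ.+-injective (sym (trans q (lemma₂ (+ a) (+ b)))))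
  where
  lemma₁ : ∀ a b → a ℤ.* + 1 ℤ.+ b ℤ.* + 0 ℤ.+ + 0 ℤ.* + 1 ≡ a
  lemma₁ = ℤ-Solver.solve-∀
  lemma₂ : ∀ a b → a ℤ.* + 0 ℤ.+ b ℤ.* + 1 ℤ.+ + 0 ℤ.* -[1+ 0 ] ≡ b
  lemma₂ = ℤ-Solver.solve-∀
V-zero (suc i) a b p q =
  V-zero i a b (trans (cong₂ ℤ._+_ p q) (V-rec i a b 0)) p

zero-Rep : ∀ {t x y} → Rep t (+ 0) (+ 0) x y → t ≡ 0
zero-Rep r with ladder r
... | i , a , b , p , q , t≤ = ℕₚ.n≤0⇒n≡0 (ℕₚ.≤-trans t≤ (ℕₚ.≤-reflexive (V-zero i a b p q)))

-- Chains of windows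

-- Windows of a fixed size fall into chains under step. If lo > 0, then step q costs as much as the
-- next larger window with the value of q; if lo = 0, then step q is q itself with another base.
step : Window → Window
step ⟨ i , zero        , b , c ⟩ = ⟨ suc i , b , c , 0 ⟩
step ⟨ i , suc zero    , b , c ⟩ = ⟨ suc i , b , c , 1 ⟩
step ⟨ i , suc (suc a) , b , c ⟩ = ⟨ i , a , b , suc (suc c) ⟩

steps : ℕ → Window → Window
steps zero    q = q
steps (suc n) q = step (steps n q)

Start : Window → Set
Start q = Window.base q ≡ 0 × Window.hi q ≤ 1

size-step : ∀ q → size (step q) ≡ size q
size-step ⟨ i , zero        , b , c ⟩ = ℕₚ.+-identityʳ (b + c)
size-step ⟨ i , suc zero    , b , c ⟩ = ℕₚ.+-comm (b + c) 1
size-step ⟨ i , suc (suc a) , b , c ⟩ = lemma a b c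
  where
  lemma : ∀ a b c → a + b + (2 + c) ≡ 2 + a + b + c
  lemma = ℕ-Solver.solve-∀

size-steps : ∀ n q → size (steps n q) ≡ size q
size-steps zero    q = refl
size-steps (suc n) q = trans (size-step (steps n q)) (size-steps n q)

step-¬Start : ∀ q → ¬ Start (step q)
step-¬Start ⟨ i , zero        , b , c ⟩ (() , _)
step-¬Start ⟨ i , suc zero    , b , c ⟩ (() , _)
step-¬Start ⟨ i , suc (suc a) , b , c ⟩ (_ , s≤s ())

-- The clause used can be read off from `hi` of the result, which is 0, 1 or at least 2.
step-injective : ∀ q q′ → step q ≡ step q′ → q ≡ q′
step-injective ⟨ _ , zero        , _ , _ ⟩ ⟨ _ , zero        , _ , _ ⟩ refl = refl
step-injective ⟨ _ , zero        , _ , _ ⟩ ⟨ _ , suc zero    , _ , _ ⟩ ()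
step-injective ⟨ _ , zero        , _ , _ ⟩ ⟨ _ , suc (suc _) , _ , _ ⟩ ()
step-injective ⟨ _ , suc zero    , _ , _ ⟩ ⟨ _ , zero        , _ , _ ⟩ ()
step-injective ⟨ _ , suc zero    , _ , _ ⟩ ⟨ _ , suc zero    , _ , _ ⟩ refl = refl
step-injective ⟨ _ , suc zero    , _ , _ ⟩ ⟨ _ , suc (suc _) , _ , _ ⟩ ()
step-injective ⟨ _ , suc (suc _) , _ , _ ⟩ ⟨ _ , zero        , _ , _ ⟩ ()
step-injective ⟨ _ , suc (suc _) , _ , _ ⟩ ⟨ _ , suc zero    , _ , _ ⟩ ()
step-injective ⟨ _ , suc (suc _) , _ , _ ⟩ ⟨ _ , suc (suc _) , _ , _ ⟩ refl = refl

steps-injective : ∀ m n {t t′} → Start t → Start t′ → steps m t ≡ steps n t′ → t ≡ t′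
steps-injective zero    zero    _ _ e = e
steps-injective zero    (suc n) {t′ = t′} s _ refl = contradiction s (step-¬Start (steps n t′))
steps-injective (suc m) zero    {t} _ s refl = contradiction s (step-¬Start (steps m t))
steps-injective (suc m) (suc n) s s′ e = steps-injective m n s s′ (step-injective _ _ e)

-- Undoing `step` lowers `hi` by 2 or the base by 1. It gets stuck exactly at the windows satisfying
-- `Start`.
chain-start : ∀ i a b c → ∃[ n ] ∃[ t ] Start t × steps n t ≡ ⟨ i , a , b , c ⟩
chain-start i       a b (suc (suc c)) with chain-start i (suc (suc a)) b c
... | n , t , s , e = suc n , t , s , cong step e
chain-start zero    a b zero       = 0 , _ , (refl , z≤n) , refl
chain-start zero    a b (suc zero) = 0 , _ , (refl , s≤s z≤n) , refl
chain-start (suc i) a b zero with chain-start i 0 a b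
... | n , t , s , e = suc n , t , s , cong step e
chain-start (suc i) a b (suc zero) with chain-start i 1 a b
... | n , t , s , e = suc n , t , s , cong step e

C-step₁ : ∀ i b c → C (suc i) b c 1 ≡ C i 0 (suc b) (suc c)
C-step₁ i b c = lemma b c (cost i) (cost (1 + i))
  where
  lemma : ∀ b c x y → b * y + c * (x + y) + 1 * (y + (x + y)) ≡ 0 * x + (1 + b) * y + (1 + c) * (x + y)
  lemma = ℕ-Solver.solve-∀

C-step₂ : ∀ i a b c → C i a b (suc (suc c)) ≡ C i (suc a) (suc b) (suc c)
C-step₂ i a b c = lemma a b c (cost i) (cost (1 + i))
  where
  lemma : ∀ a b c x y → a * x + b * y + (2 + c) * (x + y) ≡ (1 + a) * x + (1 + b) * y + (1 + c) * (x + y)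
  lemma = ℕ-Solver.solve-∀

-- Costs add upwards: γ⁻ʲ and γ⁻ʲ⁻¹ together cost as much as γ⁻ʲ⁻². So the two terms gained in
-- `next` cost as much as γ⁻ⁱ⁻³, and a remaining γ⁻ⁱ with the gained γ⁻ⁱ⁻¹ as much as γ⁻ⁱ⁻².
cost-step-next : ∀ i a b c → let q = ⟨ i , suc a , b , c ⟩; q⁺ = next i a b c in
                 cost₁ (step q) ≡ cost₁ q⁺ × cost₂ (step q) ≡ cost₂ q⁺
cost-step-next i zero    b c = C-step₁ i b c , C-step₁ (suc i) b c
cost-step-next i (suc a) b c = C-step₂ i a b c , C-step₂ (suc i) a b c

C≤C-next : ∀ i a b c → C i (suc a) b c ≤ C i a (suc b) (suc c)
C≤C-next i a b c = subst (C i (suc a) b c ≤_) (lemma a b c (cost i) (cost (1 + i))) (ℕₚ.m≤m+n _ (2 * cost (1 + i)))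
  where
  lemma : ∀ a b c x y → (1 + a) * x + b * y + c * (x + y) + 2 * y ≡ a * x + (1 + b) * y + (1 + c) * (x + y)
  lemma = ℕ-Solver.solve-∀

cost≤cost-step : ∀ q → cost₁ q ≤ cost₁ (step q) × cost₂ q ≤ cost₂ (step q)
cost≤cost-step ⟨ i , zero  , b , c ⟩ =
  ℕₚ.≤-reflexive (sym (C-shift i b c)) , ℕₚ.≤-reflexive (sym (C-shift (suc i) b c))
cost≤cost-step ⟨ i , suc a , b , c ⟩ with cost-step-next i a b c
... | p , q = subst (C i (suc a) b c ≤_) (sym p) (C≤C-next i a b c) ,
              subst (C (suc i) (suc a) b c ≤_) (sym q) (C≤C-next (suc i) a b c)

-- Strictly increases under step, while for windows of a given size it is bounded in terms of base:
-- so base, and with it the cost, is unbounded along a chain.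
position : Window → ℕ
position ⟨ i , a , b , c ⟩ = i * suc (a + b + c) + (b + c)

position-step : ∀ q → position q < position (step q)
position-step ⟨ i , zero , b , c ⟩ =
  subst (suc (position ⟨ i , 0 , b , c ⟩) ≤_) (lemma i b c) (ℕₚ.m≤m+n _ c)
  where
  lemma : ∀ i b c → 1 + (i * (1 + (b + c)) + (b + c)) + c ≡ (1 + i) * (1 + (b + c + 0)) + (c + 0)
  lemma = ℕ-Solver.solve-∀
position-step ⟨ i , suc zero , b , c ⟩ =
  subst (suc (position ⟨ i , 1 , b , c ⟩) ≤_) (lemma i b c) (ℕₚ.m≤m+n _ (2 + c))
  where
  lemma : ∀ i b c → 1 + (i * (1 + (1 + b + c)) + (b + c)) + (2 + c) ≡ (1 + i) * (1 + (b + c + 1)) + (c + 1)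
  lemma = ℕ-Solver.solve-∀
position-step ⟨ i , suc (suc a) , b , c ⟩ =
  subst (suc (position ⟨ i , 2 + a , b , c ⟩) ≤_) (lemma i a b c) (ℕₚ.m≤m+n _ 1)
  where
  lemma : ∀ i a b c → 1 + (i * (1 + (2 + a + b + c)) + (b + c)) + 1 ≡ i * (1 + (a + b + (2 + c))) + (b + (2 + c))
  lemma = ℕ-Solver.solve-∀

n≤position : ∀ n t → n ≤ position (steps n t)
n≤position zero    t = z≤n
n≤position (suc n) t = ℕₚ.≤-trans (s≤s (n≤position n t)) (position-step (steps n t))

position<base : ∀ q → position q < suc (Window.base q) * suc (size q)
position<base ⟨ i , a , b , c ⟩ =
  subst (suc (position ⟨ i , a , b , c ⟩) ≤_) (lemma i a b c) (ℕₚ.m≤m+n _ a)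
  where
  lemma : ∀ i a b c → 1 + (i * (1 + (a + b + c)) + (b + c)) + a ≡ (1 + i) * (1 + (a + b + c))
  lemma = ℕ-Solver.solve-∀

j≤cost : ∀ j → j ≤ cost (2 + j)
j≤cost zero          = z≤n
j≤cost (suc zero)    = s≤s z≤n
j≤cost (suc (suc j)) = ℕₚ.+-mono-≤ (cost-pos j) (j≤cost (suc j))

-- Over both coordinates γ⁻ʲ costs `cost (2 + j)`, which is at least `j`; one term is enough.
base≤total-cost : ∀ q → 1 ≤ size q → Window.base q ≤ cost₁ q + cost₂ q
base≤total-cost ⟨ i , a , b , c ⟩ 1≤s = begin
  i                                   ≡⟨ ℕₚ.*-identityˡ i ⟨
  1 * i                               ≤⟨ ℕₚ.*-monoˡ-≤ i 1≤s ⟩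
  (a + b + c) * i                     ≡⟨ lemma a b c i ⟩
  a * i + b * i + c * i
    ≤⟨ ℕₚ.+-mono-≤ (ℕₚ.+-mono-≤ (ℕₚ.*-monoʳ-≤ a (j≤cost i))
         (ℕₚ.*-monoʳ-≤ b (ℕₚ.≤-trans (ℕₚ.n≤1+n i) (j≤cost (1 + i)))))
         (ℕₚ.*-monoʳ-≤ c (ℕₚ.≤-trans (ℕₚ.m≤n+m i 2) (j≤cost (2 + i)))) ⟩
  C (2 + i) a b c                     ≡⟨ C-rec i a b c ⟩
  C i a b c + C (1 + i) a b c         ∎
  where
  open ℕₚ.≤-Reasoning
  lemma : ∀ a b c i → (a + b + c) * i ≡ a * i + b * i + c * i
  lemma = ℕ-Solver.solve-∀

-- The last fitting window of a chain

module _ (d₁ d₂ : ℕ) where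

  Fits : Window → Set
  Fits q = cost₁ q ≤ d₁ × cost₂ q ≤ d₂

  fits? : ∀ q → Dec (Fits q)
  fits? q = (cost₁ q ℕₚ.≤? d₁) ×-dec (cost₂ q ℕₚ.≤? d₂)

  Last : Window → Set
  Last q = Fits q × ¬ Fits (step q)

  fits-step⁻¹ : ∀ q → Fits (step q) → Fits q
  fits-step⁻¹ q (p₁ , p₂) =
    ℕₚ.≤-trans (proj₁ (cost≤cost-step q)) p₁ , ℕₚ.≤-trans (proj₂ (cost≤cost-step q)) p₂

  fits-steps⁻¹ : ∀ k n t → Fits (steps (k + n) t) → Fits (steps n t)
  fits-steps⁻¹ zero    n t p = p
  fits-steps⁻¹ (suc k) n t p = fits-steps⁻¹ k n t (fits-step⁻¹ (steps (k + n) t) p)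

  fits-start : ∀ n t → Fits (steps n t) → Fits t
  fits-start n t p = fits-steps⁻¹ n 0 t (subst (λ k → Fits (steps k t)) (sym (ℕₚ.+-identityʳ n)) p)

  last-unique : ∀ m n t → Last (steps m t) → Last (steps n t) → m ≡ n
  last-unique m n t (p , ¬p) (r , ¬r) = ℕₚ.≤-antisym (ℕₚ.≮⇒≥ (beyond n m ¬r p)) (ℕₚ.≮⇒≥ (beyond m n ¬p r))
    where
    beyond : ∀ m n → ¬ Fits (steps (suc m) t) → Fits (steps n t) → ¬ m < n
    beyond m n ¬p p m<n = ¬p (fits-steps⁻¹ (n ∸ suc m) (suc m) t
      (subst (λ k → Fits (steps k t)) (sym (ℕₚ.m∸n+n≡m m<n)) p))

  far-misfit : ∀ t → 1 ≤ size t → ∃[ n ] ¬ Fits (steps n t)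
  far-misfit t 1≤s = n , λ (p₁ , p₂) → ℕₚ.<⇒≱ base> (ℕₚ.≤-trans
      (base≤total-cost q (subst (1 ≤_) (sym (size-steps n t)) 1≤s)) (ℕₚ.+-mono-≤ p₁ p₂))
    where
    -- `position` is then at least `n`, so `position<base` forces the base above `d₁ + d₂`.
    n = suc (d₁ + d₂) * suc (size t)
    q = steps n t
    base> : d₁ + d₂ < Window.base q
    base> = ℕₚ.≤-pred (ℕₚ.*-cancelʳ-< (suc (size t)) (suc (d₁ + d₂)) (suc (Window.base q))
      (ℕₚ.≤-<-trans (n≤position n t)
        (subst (λ s → position q < suc (Window.base q) * suc s) (size-steps n t) (position<base q))))

  last-exists : ∀ t → 1 ≤ size t → Fits t → ∃[ n ] Last (steps n t)
  last-exists t 1≤s p = let k , ¬p = far-misfit t 1≤s in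
      search k 0 p (subst (λ n → ¬ Fits (steps n t)) (sym (ℕₚ.+-identityʳ k)) ¬p)
    where
    search : ∀ k n → Fits (steps n t) → ¬ Fits (steps (k + n) t) → ∃[ m ] Last (steps m t)
    search zero    n p ¬p = contradiction p ¬p
    search (suc k) n p ¬p with fits? (steps (suc n) t)
    ... | no ¬p′ = n , p , ¬p′
    ... | yes p′ = search k (suc n) p′ (subst (λ m → ¬ Fits (steps m t)) (sym (ℕₚ.+-suc k n)) ¬p)

  -- For `lo` zero, `step` keeps the cost, so the following window would fit too.
  last-lo : ∀ q → Last q → ∃[ a ] Window.lo q ≡ suc a
  last-lo ⟨ i , zero  , b , c ⟩ ((p₁ , p₂) , ¬p) = contradiction
    (subst (_≤ d₁) (sym (C-shift i b c)) p₁ , subst (_≤ d₂) (sym (C-shift (suc i) b c)) p₂) ¬p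
  last-lo ⟨ i , suc a , b , c ⟩ _ = a , refl

-- Transport of finite cardinalities

module _ {A B : Set} {P : A → Set} (R : A → B → Set)
         (image : ∀ {x} → P x → ∃[ y ] R x y)
         (injective : ∀ {x x′ y} → P x → P x′ → R x y → R x′ y → x ≡ x′) where

  images : ∀ xs → Unique xs → All P xs → ∃[ ys ] Unique ys × length ys ≡ length xs ×
           (∀ {y} → y ∈ ys → ∃[ x ] x ∈ xs × R x y) × (∀ {x} → x ∈ xs → ∃[ y ] y ∈ ys × R x y)
  images []       []       []       = [] , [] , refl , (λ ()) , (λ ())
  images (x ∷ xs) (x∉ ∷ u) (p ∷ ps) with image p | images xs u ps
  ... | y , r | ys , v , l , back , forth =
    y ∷ ys , All.tabulate y∉ ∷ v , cong suc l , back′ , forth′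
    where
    y∉ : ∀ {z} → z ∈ ys → y ≢ z
    y∉ z∈ refl = let x′ , x′∈ , r′ = back z∈ in
      All.lookup x∉ x′∈ (injective p (All.lookup ps x′∈) r r′)
    back′ : ∀ {z} → z ∈ y ∷ ys → ∃[ x′ ] x′ ∈ x ∷ xs × R x′ z
    back′ (here refl) = x , here refl , r
    back′ (there z∈)  = let x′ , x′∈ , r′ = back z∈ in x′ , there x′∈ , r′
    forth′ : ∀ {x′} → x′ ∈ x ∷ xs → ∃[ z ] z ∈ y ∷ ys × R x′ z
    forth′ (here refl) = y , here refl , r
    forth′ (there x′∈) = let z , z∈ , r′ = forth x′∈ in z , there z∈ , r′

  -- A relation replaces a function because the partner of `x` may exist only given `P x`: a chain
  -- has a last fitting window only if its start fits.
  HasCardinality-image : ∀ {Q : B → Set} {n} →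
    (∀ {x y} → P x → R x y → Q y) → (∀ {y} → Q y → ∃[ x ] P x × R x y) →
    (∀ {x y y′} → P x → R x y → R x y′ → y ≡ y′) →
    HasCardinality P n → HasCardinality Q n
  HasCardinality-image {Q} sound complete functional (xs , u , l , ∈⇔P)
    with images xs u (All.tabulate (λ {x} → Equivalence.to (∈⇔P x)))
  ... | ys , v , l′ , back , forth = ys , v , trans l′ l , λ y → mk⇔ to from
    where
    to : ∀ {y} → y ∈ ys → Q y
    to y∈ = let x , x∈ , r = back y∈ in sound (Equivalence.to (∈⇔P x) x∈) r
    from : ∀ {y} → Q y → y ∈ ys
    from q with complete q
    ... | x , p , r with forth (Equivalence.from (∈⇔P x) p)
    ...   | y′ , y′∈ , r′ = subst (_∈ ys) (functional p r′ r) y′∈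

HasCardinality-< : ∀ n → HasCardinality (_< n) n
HasCardinality-< n = upTo n , upTo⁺ n , length-upTo n , λ _ → mk⇔ ∈-upTo⁻ ∈-upTo⁺

-- Counting the fitting starts

2j+c<2j′ : ∀ {j j′ c} → c ≤ 1 → j < j′ → 2 * j + c < 2 * j′
2j+c<2j′ {j} {j′} c≤1 j<j′ = ℕₚ.≤-trans (s≤s (ℕₚ.+-monoʳ-≤ (2 * j) c≤1))
  (subst (_≤ 2 * j′) (lemma j) (ℕₚ.*-monoʳ-≤ 2 j<j′))
  where
  lemma : ∀ j → 2 * (1 + j) ≡ 1 + (2 * j + 1)
  lemma = ℕ-Solver.solve-∀

binary-≡ : ∀ {j j′ c c′} → c ≤ 1 → c′ ≤ 1 → 2 * j + c ≡ 2 * j′ + c′ → j ≡ j′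
binary-≡ {j} {j′} {c} {c′} c≤1 c′≤1 e with ℕₚ.<-cmp j j′
... | tri≈ _ j≡j′ _ = j≡j′
... | tri< j<j′ _ _ = contradiction e (ℕₚ.<⇒≢ (ℕₚ.≤-trans (2j+c<2j′ c≤1 j<j′) (ℕₚ.m≤m+n (2 * j′) c′)))
... | tri> _ _ j′<j = contradiction (sym e) (ℕₚ.<⇒≢ (ℕₚ.≤-trans (2j+c<2j′ c′≤1 j′<j) (ℕₚ.m≤m+n (2 * j) c)))

-- With `c ≤ 1`, the pairs satisfying `j + c ≤ m` number `m + 1` for `c = 0` and `m` for `c = 1`.
-- Their codes `2 * j + c` fill the range below `2 * m + 1`, which explains the shape of the final
-- count.
binary-bound⁺ : ∀ {j c m} → j + c ≤ m → 2 * j + c < 2 * m + 1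
binary-bound⁺ {j} {c} {m} j+c≤m = begin-strict
  2 * j + c       ≤⟨ ℕₚ.+-monoʳ-≤ (2 * j) (ℕₚ.m≤m+n c (c + 0)) ⟩
  2 * j + 2 * c   ≡⟨ ℕₚ.*-distribˡ-+ 2 j c ⟨
  2 * (j + c)     ≤⟨ ℕₚ.*-monoʳ-≤ 2 j+c≤m ⟩
  2 * m           <⟨ ℕₚ.m<m+n (2 * m) (s≤s z≤n) ⟩
  2 * m + 1       ∎
  where open ℕₚ.≤-Reasoning

binary-bound⁻ : ∀ {j c m} → c ≤ 1 → 2 * j + c < 2 * m + 1 → j + c ≤ m
binary-bound⁻ {j} {c} {m} c≤1 k< = ℕₚ.≮⇒≥ λ m<j+c → ℕₚ.<⇒≱ k< (ℕₚ.+-cancelʳ-≤ 1 _ _ (begin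
  2 * m + 1 + 1       ≡⟨ lemma m ⟩
  2 * suc m           ≤⟨ ℕₚ.*-monoʳ-≤ 2 m<j+c ⟩
  2 * (j + c)         ≡⟨ lemma′ j c ⟩
  2 * j + c + c       ≤⟨ ℕₚ.+-monoʳ-≤ (2 * j + c) c≤1 ⟩
  2 * j + c + 1       ∎))
  where
  open ℕₚ.≤-Reasoning
  lemma : ∀ m → 2 * m + 1 + 1 ≡ 2 * (1 + m)
  lemma = ℕ-Solver.solve-∀
  lemma′ : ∀ j c → 2 * (j + c) ≡ 2 * j + c + c
  lemma′ = ℕ-Solver.solve-∀

binary : ∀ k → ∃[ j ] ∃[ c ] c ≤ 1 × k ≡ 2 * j + c
binary k = k DivMod./ 2 , k DivMod.% 2 , ℕₚ.≤-pred (DivMod.m%n<n k 2) ,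
  trans (DivMod.m≡m%n+[m/n]*n k 2) (trans (ℕₚ.+-comm (k DivMod.% 2) _)
    (cong (_+ k DivMod.% 2) (ℕₚ.*-comm (k DivMod./ 2) 2)))

StartOfSize : (d₁ d₂ s : ℕ) → Window → Set
StartOfSize d₁ d₂ s q = Start q × size q ≡ s × Fits d₁ d₂ q

C₀ : ∀ a b c → C 0 a b c ≡ a + c
C₀ = lemma
  where
  lemma : ∀ a b c → a * 1 + b * 0 + c * 1 ≡ a + c
  lemma = ℕ-Solver.solve-∀

C₁ : ∀ a b c → C 1 a b c ≡ b + c
C₁ = lemma
  where
  lemma : ∀ a b c → a * 0 + b * 1 + c * 1 ≡ b + c
  lemma = ℕ-Solver.solve-∀

module _ (d₁ d₂ s : ℕ) (s≤d₁+d₂ : s ≤ d₁ + d₂) where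

  private
    -- For a start of size `s` with entries `a`, `b`, `c`, the bound `a + c ≤ d₁` amounts to
    -- `l ≤ b`; the bound `b + c ≤ d₂` and `b + c ≤ s` combine to `b + c ≤ h`.
    l h : ℕ
    l = s ∸ d₁
    h = s ⊓ d₂

    s≤d₁+l : s ≤ d₁ + l
    s≤d₁+l = ℕₚ.m≤n+m∸n s d₁

    l≤h : l ≤ h
    l≤h = ℕₚ.⊓-glb (ℕₚ.m∸n≤m s d₁) (ℕₚ.m≤n+o⇒m∸n≤o s d₁ s≤d₁+d₂)

    -- Here `k` stands for `2 * (mid - l) + hi`; adding `2 * l` avoids truncated subtraction.
    Code : ℕ → Window → Set
    Code k q = StartOfSize d₁ d₂ s q × k + 2 * l ≡ 2 * Window.mid q + Window.hi q

    window : ∀ b c → c ≤ 1 → l ≤ b → b + c ≤ h → StartOfSize d₁ d₂ s ⟨ 0 , s ∸ (b + c) , b , c ⟩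
    window b c c≤1 l≤b b+c≤h = (refl , c≤1) ,
      trans (ℕₚ.+-assoc _ b c) (ℕₚ.m∸n+n≡m b+c≤s) ,
      subst (_≤ d₁) (sym (C₀ (s ∸ (b + c)) b c)) (ℕₚ.+-cancelʳ-≤ b _ _ (begin
        s ∸ (b + c) + c + b     ≡⟨ ℕₚ.+-assoc _ c b ⟩
        s ∸ (b + c) + (c + b)   ≡⟨ cong (_+_ (s ∸ (b + c))) (ℕₚ.+-comm c b) ⟩
        s ∸ (b + c) + (b + c)   ≡⟨ ℕₚ.m∸n+n≡m b+c≤s ⟩
        s                       ≤⟨ s≤d₁+l ⟩
        d₁ + l                  ≤⟨ ℕₚ.+-monoʳ-≤ d₁ l≤b ⟩
        d₁ + b                  ∎)) ,
      subst (_≤ d₂) (sym (C₁ (s ∸ (b + c)) b c)) (ℕₚ.≤-trans b+c≤h (ℕₚ.m⊓n≤n s d₂))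
      where
      open ℕₚ.≤-Reasoning
      b+c≤s : b + c ≤ s
      b+c≤s = ℕₚ.≤-trans b+c≤h (ℕₚ.m⊓n≤m s d₂)

    bounds : ∀ q → StartOfSize d₁ d₂ s q → l ≤ Window.mid q × Window.mid q + Window.hi q ≤ h
    bounds ⟨ _ , a , b , c ⟩ ((refl , _) , refl , p₁ , p₂) =
      ℕₚ.m≤n+o⇒m∸n≤o _ d₁ (subst (_≤ d₁ + b) (lemma a b c)
        (ℕₚ.+-monoˡ-≤ b (subst (_≤ d₁) (C₀ a b c) p₁))) ,
      ℕₚ.⊓-glb (subst (b + c ≤_) (sym (ℕₚ.+-assoc a b c)) (ℕₚ.m≤n+m (b + c) a))
               (subst (_≤ d₂) (C₁ a b c) p₂)
      where
      lemma : ∀ a b c → a + c + b ≡ a + b + c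
      lemma = ℕ-Solver.solve-∀

    shift : ∀ j c l → 2 * j + c + 2 * l ≡ 2 * (l + j) + c
    shift = ℕ-Solver.solve-∀

    code⇒window : ∀ {k} → k < 2 * (h ∸ l) + 1 → ∃[ q ] Code k q
    code⇒window {k} k< with binary k
    ... | j , c , c≤1 , refl = ⟨ 0 , s ∸ (l + j + c) , l + j , c ⟩ ,
      window (l + j) c c≤1 (ℕₚ.m≤m+n l j) (subst (_≤ h) (sym (ℕₚ.+-assoc l j c))
        (subst (l + (j + c) ≤_) (ℕₚ.m+[n∸m]≡n l≤h)
          (ℕₚ.+-monoʳ-≤ l (binary-bound⁻ {j} c≤1 k<)))) ,
      shift j c l

    window⇒code : ∀ q → StartOfSize d₁ d₂ s q → ∃[ k ] k < 2 * (h ∸ l) + 1 × Code k q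
    window⇒code q@(⟨ _ , a , b , c ⟩) p with bounds q p
    ... | l≤b , b+c≤h = 2 * (b ∸ l) + c ,
      binary-bound⁺ {b ∸ l} {c} (ℕₚ.+-cancelˡ-≤ l _ _ (subst₂ _≤_
        (trans (cong (_+ c) (sym (ℕₚ.m+[n∸m]≡n l≤b))) (ℕₚ.+-assoc l (b ∸ l) c))
        (sym (ℕₚ.m+[n∸m]≡n l≤h)) b+c≤h)) ,
      p , trans (shift (b ∸ l) c l) (cong (λ x → 2 * x + c) (ℕₚ.m+[n∸m]≡n l≤b))

    code-functional : ∀ {k} q q′ → Code k q → Code k q′ → q ≡ q′
    code-functional ⟨ _ , a , b , c ⟩ ⟨ _ , a′ , b′ , c′ ⟩
      (((refl , c≤1) , s≡ , _) , e) (((refl , c′≤1) , s≡′ , _) , e′) 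
      with binary-≡ {b} {b′} c≤1 c′≤1 (trans (sym e) e′)
    ... | refl with ℕₚ.+-cancelˡ-≡ (2 * b) c c′ (trans (sym e) e′)
    ...   | refl with ℕₚ.+-cancelʳ-≡ (b + c) a a′
                        (trans (sym (ℕₚ.+-assoc a b c)) (trans (trans s≡ (sym s≡′)) (ℕₚ.+-assoc a′ b c)))
    ...     | refl = refl

  starts-cardinality : HasCardinality (StartOfSize d₁ d₂ s) (2 * (s ⊓ d₂ ∸ (s ∸ d₁)) + 1)
  starts-cardinality = HasCardinality-image Code code⇒window
    (λ {x} {x′} _ _ (_ , e) (_ , e′) → ℕₚ.+-cancelʳ-≡ (2 * l) x x′ (trans e (sym e′)))
    (λ _ → proj₁) (λ {q} → window⇒code q) (λ {k} {q} {q′} _ → code-functional {k} q q′) (HasCardinality-< _)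

-- For `d₁ ≤ s` the left side is the minimum of `d₁` and `d₁ + d₂ ∸ s`, otherwise that of `s` and
-- `d₂`. In both cases the other two entries on the right do not lower the minimum.
⊓-∸-formula : ∀ d₁ d₂ s → s ⊓ d₂ ∸ (s ∸ d₁) ≡ d₁ ⊓ d₂ ⊓ s ⊓ (d₁ + d₂ ∸ s)
⊓-∸-formula d₁ d₂ s with ℕₚ.≤-total d₁ s
... | inj₁ d₁≤s with ℕₚ.m≤n⇒∃[o]m+o≡n d₁≤s
...   | e , refl = begin
  (d₁ + e) ⊓ d₂ ∸ (d₁ + e ∸ d₁)               ≡⟨ cong ((d₁ + e) ⊓ d₂ ∸_) (ℕₚ.m+n∸m≡n d₁ e) ⟩
  (d₁ + e) ⊓ d₂ ∸ e                           ≡⟨ ℕₚ.∸-distribʳ-⊓ e (d₁ + e) d₂ ⟩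
  (d₁ + e ∸ e) ⊓ (d₂ ∸ e)                     ≡⟨ cong₂ _⊓_ (ℕₚ.m+n∸n≡m d₁ e) (sym (ℕₚ.m≥n⇒m⊓n≡n (ℕₚ.m∸n≤m d₂ e))) ⟩
  d₁ ⊓ (d₂ ⊓ (d₂ ∸ e))                        ≡⟨ ℕₚ.⊓-assoc d₁ d₂ (d₂ ∸ e) ⟨
  d₁ ⊓ d₂ ⊓ (d₂ ∸ e)
    ≡⟨ cong₂ _⊓_ (ℕₚ.m≤n⇒m⊓n≡m (ℕₚ.≤-trans (ℕₚ.m⊓n≤m d₁ d₂) d₁≤s)) (ℕₚ.[m+n]∸[m+o]≡n∸o d₁ d₂ e) ⟨
  d₁ ⊓ d₂ ⊓ (d₁ + e) ⊓ (d₁ + d₂ ∸ (d₁ + e))   ∎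
  where open ≡-Reasoning
⊓-∸-formula d₁ d₂ s | inj₂ s≤d₁ = begin
  s ⊓ d₂ ∸ (s ∸ d₁)                     ≡⟨ cong (s ⊓ d₂ ∸_) (ℕₚ.m≤n⇒m∸n≡0 s≤d₁) ⟩
  s ⊓ d₂                                ≡⟨ ℕₚ.⊓-comm s d₂ ⟩
  d₂ ⊓ s                                ≡⟨ ℕₚ.m≥n⇒m⊓n≡n (ℕₚ.≤-trans (ℕₚ.m⊓n≤n d₂ s) s≤d₁) ⟨
  d₁ ⊓ (d₂ ⊓ s)                         ≡⟨ ℕₚ.⊓-assoc d₁ d₂ s ⟨
  d₁ ⊓ d₂ ⊓ s                           ≡⟨ ℕₚ.m≤n⇒m⊓n≡m bound ⟨
  d₁ ⊓ d₂ ⊓ s ⊓ (d₁ + d₂ ∸ s)           ∎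
  where
  open ≡-Reasoning
  bound : d₁ ⊓ d₂ ⊓ s ≤ d₁ + d₂ ∸ s
  bound = ℕₚ.≤-trans (ℕₚ.≤-trans (ℕₚ.m⊓n≤m (d₁ ⊓ d₂) s) (ℕₚ.m⊓n≤n d₁ d₂))
    (subst (_≤ d₁ + d₂ ∸ s) (ℕₚ.m+n∸m≡n d₁ d₂) (ℕₚ.∸-monoʳ-≤ (d₁ + d₂) s≤d₁))

-- Largest lengths and last windows

value : Window → ℤ × ℤ
value q = val₁ q , val₂ q

module _ (d₁ d₂ : ℕ) where

  PointRep⇒Rep : ∀ {m n s} → PointRep d₁ d₂ (m , n) s →
                 ∃[ a ] ∃[ b ] Rep s m n a b × a ≤ d₁ × b ≤ d₂
  PointRep⇒Rep (i , refl , adm) =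
    let a , b , r , p , q = vector⇒Rep i (Admissible.nonNegative adm) in
    a , b , r , ℤₚ.drop‿+≤+ (subst (ℤ._≤ + d₁) p (Admissible.bound₁ adm)) ,
                ℤₚ.drop‿+≤+ (subst (ℤ._≤ + d₂) q (Admissible.bound₂ adm))

  Fits⇒PointRep : ∀ q → Fits d₁ d₂ q → PointRep d₁ d₂ (value q) (size q)
  Fits⇒PointRep ⟨ i , a , b , c ⟩ (p₁ , p₂) = index , cong₂ _,_ sum-m sum-n , record
    { nonNegative = λ k → ℤₚ.≤-trans (ℤ.+≤+ z≤n) (lower-bound k)
    ; monotone    = monotone
    ; bound₁      = subst (ℤ._≤ + d₁) (sym sum-a) (ℤ.+≤+ p₁)
    ; bound₂      = subst (ℤ._≤ + d₂) (sym sum-b) (ℤ.+≤+ p₂)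
    }
    where open OrderedRep (window-ordered i a b c)

  PointRep-size : ∀ {p s} → PointRep d₁ d₂ p s → s ≤ d₁ + d₂
  PointRep-size r = let _ , _ , r′ , a≤ , b≤ = PointRep⇒Rep r in
    ℕₚ.≤-trans (size≤total-cost r′) (ℕₚ.+-mono-≤ a≤ b≤)

  -- The dominating window fits and has at least `s` terms, so maximality leaves exactly `s`.
  largest-window : ∀ {p s} → IsLargest (PointRep d₁ d₂ p) s →
                   ∃[ q ] Fits d₁ d₂ q × size q ≡ s × p ≡ value q
  largest-window (rep , max) with PointRep⇒Rep rep
  ... | a , b , r , a≤ , b≤ with dominating-window r
  ...   | q , refl , refl , s≤ , p₁ , p₂ = q , fits , ℕₚ.≤-antisym (max _ (Fits⇒PointRep q fits)) s≤ , refl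
    where
    fits : Fits d₁ d₂ q
    fits = ℕₚ.≤-trans p₁ a≤ , ℕₚ.≤-trans p₂ b≤

  fits-shift : ∀ i b c → Fits d₁ d₂ ⟨ i , 0 , b , c ⟩ → Fits d₁ d₂ ⟨ suc i , b , c , 0 ⟩
  fits-shift i b c (p₁ , p₂) =
    subst (_≤ d₁) (sym (C-shift i b c)) p₁ , subst (_≤ d₂) (sym (C-shift (suc i) b c)) p₂

  normalise : ∀ i a b c → 1 ≤ a + b + c → Fits d₁ d₂ ⟨ i , a , b , c ⟩ →
              ∃[ i′ ] ∃[ a′ ] ∃[ b′ ] ∃[ c′ ] let q = ⟨ i , a , b , c ⟩; q′ = ⟨ i′ , suc a′ , b′ , c′ ⟩ in
              Fits d₁ d₂ q′ × size q′ ≡ size q × value q′ ≡ value q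
  normalise i (suc a) b c 1≤ p = i , a , b , c , p , refl , refl
  normalise i zero (suc b) c 1≤ p =
    suc i , b , c , 0 , fits-shift i (suc b) c p , ℕₚ.+-identityʳ _ ,
    cong₂ _,_ (V-shift i (suc b) c) (V-shift (suc i) (suc b) c)
  normalise i zero zero (suc c) 1≤ p =
    suc (suc i) , c , 0 , 0 , fits-shift (suc i) (suc c) 0 (fits-shift i 0 (suc c) p) ,
    trans (ℕₚ.+-identityʳ _) (ℕₚ.+-identityʳ _) ,
    cong₂ _,_ (trans (V-shift (suc i) (suc c) 0) (V-shift i 0 (suc c)))
              (trans (V-shift (suc (suc i)) (suc c) 0) (V-shift (suc i) 0 (suc c)))

  -- If `step q′` fitted, so would `q⁺`, which has the same cost, and the point would have a
  -- representation with one more term.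
  largest⇒last : ∀ {p s} → 1 ≤ s → IsLargest (PointRep d₁ d₂ p) s →
                 ∃[ q ] Last d₁ d₂ q × size q ≡ s × p ≡ value q
  largest⇒last 1≤s L@(_ , max) with largest-window L
  ... | ⟨ i , a , b , c ⟩ , fits , refl , refl with normalise i a b c 1≤s fits
  ...   | i′ , a′ , b′ , c′ , fits′ , s≡ , v≡ = q′ , (fits′ , ¬fits) , s≡ , sym v≡
    where
    q′ q⁺ : Window
    q′ = ⟨ i′ , suc a′ , b′ , c′ ⟩
    q⁺ = next i′ a′ b′ c′
    value-q⁺ : value q⁺ ≡ value ⟨ i , a , b , c ⟩
    value-q⁺ = trans (cong₂ _,_ (V-next i′ a′ b′ c′) (V-next (suc i′) a′ b′ c′)) v≡
    ¬fits : ¬ Fits d₁ d₂ (step q′)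
    ¬fits (p₁ , p₂) = let e₁ , e₂ = cost-step-next i′ a′ b′ c′ in
      ℕₚ.<-irrefl refl (ℕₚ.≤-trans (ℕₚ.≤-reflexive (sym (trans (size-next i′ a′ b′ c′) (cong suc s≡))))
        (max _ (subst (λ p → PointRep d₁ d₂ p (size q⁺)) value-q⁺
          (Fits⇒PointRep q⁺ (subst (_≤ d₁) e₁ p₁ , subst (_≤ d₂) e₂ p₂)))))

  -- A longer representation costs at least as much as `next`, by `window-minimal`. So `next`, and
  -- with it `step q`, would fit.
  last⇒largest : ∀ q → Last d₁ d₂ q → IsLargest (PointRep d₁ d₂ (value q)) (size q)
  last⇒largest q@(⟨ i , zero , b , c ⟩) last with last-lo d₁ d₂ q last
  ... | ()
  last⇒largest q@(⟨ i , suc a , b , c ⟩) (fits , ¬fits) = Fits⇒PointRep q fits , λ t rep →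
    ℕₚ.≮⇒≥ λ s<t →
      let _ , _ , r , a≤ , b≤ = PointRep⇒Rep rep
          p₁ , p₂ = window-minimal (next i a b c) r (sym (V-next i a b c)) (sym (V-next (suc i) a b c))
                      (subst (_≤ t) (sym (size-next i a b c)) s<t)
          e₁ , e₂ = cost-step-next i a b c
      in ¬fits (subst (_≤ d₁) (sym e₁) (ℕₚ.≤-trans p₁ a≤) , subst (_≤ d₂) (sym e₂) (ℕₚ.≤-trans p₂ b≤))

  last-injective : ∀ q q′ → Last d₁ d₂ q → Last d₁ d₂ q′ → size q ≡ size q′ → value q ≡ value q′ → q ≡ q′
  last-injective q@(⟨ _ , zero , _ , _ ⟩) _ last _ _ _ with last-lo d₁ d₂ q last
  ... | ()
  last-injective ⟨ _ , suc _ , _ , _ ⟩ q′@(⟨ _ , zero , _ , _ ⟩) _ last _ _ with last-lo d₁ d₂ q′ last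
  ... | ()
  last-injective ⟨ i , suc a , b , c ⟩ ⟨ i′ , suc a′ , b′ , c′ ⟩ _ _ s≡ v≡ =
    window-unique i a b c i′ a′ b′ c′ s≡ (cong proj₁ v≡) (cong proj₂ v≡)

  LastOfChain : Window → ℤ × ℤ → Set
  LastOfChain t p = ∃[ n ] Last d₁ d₂ (steps n t) × p ≡ value (steps n t)

  -- Distinct chains are disjoint, and a last window is determined by its value and size, so fitting
  -- starts correspond to points. For `1 ≤ s` every chain eventually stops fitting.
  largest-cardinality : ∀ {s k} → 1 ≤ s → HasCardinality (StartOfSize d₁ d₂ s) k →
                        HasCardinality (λ p → IsLargest (PointRep d₁ d₂ p) s) k
  largest-cardinality {s} 1≤s = HasCardinality-image LastOfChain image injective sound complete functional
    where
    image : ∀ {t} → StartOfSize d₁ d₂ s t → ∃[ p ] LastOfChain t p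
    image {t} (_ , refl , fits) = let n , last = last-exists d₁ d₂ t 1≤s fits in
      value (steps n t) , n , last , refl
    injective : ∀ {t t′ p} → StartOfSize d₁ d₂ s t → StartOfSize d₁ d₂ s t′ →
                LastOfChain t p → LastOfChain t′ p → t ≡ t′
    injective {t} {t′} (st , s≡ , _) (st′ , s≡′ , _) (n , last , e) (n′ , last′ , e′) =
      steps-injective n n′ st st′ (last-injective (steps n t) (steps n′ t′) last last′
        (trans (trans (size-steps n t) s≡) (sym (trans (size-steps n′ t′) s≡′))) (trans (sym e) e′))
    sound : ∀ {t p} → StartOfSize d₁ d₂ s t → LastOfChain t p → IsLargest (PointRep d₁ d₂ p) s
    sound {t} (_ , refl , _) (n , last , refl) =
      subst (IsLargest (PointRep d₁ d₂ (value (steps n t)))) (size-steps n t) (last⇒largest (steps n t) last)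
    complete : ∀ {p} → IsLargest (PointRep d₁ d₂ p) s → ∃[ t ] StartOfSize d₁ d₂ s t × LastOfChain t p
    complete L with largest⇒last 1≤s L
    ... | ⟨ i , a , b , c ⟩ , last , s≡ , p≡ with chain-start i a b c
    ...   | n , t , st , e =
      t , (st , trans (sym (size-steps n t)) (trans (cong size e) s≡) ,
           fits-start d₁ d₂ n t (subst (Fits d₁ d₂) (sym e) (proj₁ last))) ,
      n , subst (Last d₁ d₂) (sym e) last , trans p≡ (cong value (sym e))
    functional : ∀ {t p p′} → StartOfSize d₁ d₂ s t → LastOfChain t p → LastOfChain t p′ → p ≡ p′
    functional {t} _ (n , last , e) (n′ , last′ , e′) =
      trans e (trans (cong (λ k → value (steps k t)) (last-unique d₁ d₂ n n′ t last last′)) (sym e′))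

  -- The empty window is treated apart: its cost stays 0 along the chain, so there is no last
  -- window.
  largest-0-cardinality : HasCardinality (λ p → IsLargest (PointRep d₁ d₂ p) 0) 1
  largest-0-cardinality = (+ 0 , + 0) ∷ [] , [] ∷ [] , refl , λ p → mk⇔
    (λ { (here refl) → Fits⇒PointRep ⟨ 0 , 0 , 0 , 0 ⟩ (z≤n , z≤n) ,
           λ t rep → let _ , _ , r , _ = PointRep⇒Rep rep in ℕₚ.≤-reflexive (zero-Rep r) })
    (λ { ((_ , refl , _) , _) → here refl })

  point-cardinality : ∀ s → s ≤ d₁ + d₂ → HasCardinality (λ p → IsLargest (PointRep d₁ d₂ p) s)
                                            (2 * (d₁ ⊓ d₂ ⊓ s ⊓ (d₁ + d₂ ∸ s)) + 1)
  point-cardinality zero    _   = subst (λ k → HasCardinality (λ p → IsLargest (PointRep d₁ d₂ p) 0) (2 * k + 1))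
    (sym (cong (_⊓ (d₁ + d₂)) (ℕₚ.⊓-zeroʳ (d₁ ⊓ d₂)))) largest-0-cardinality
  point-cardinality s@(suc _) s≤ = largest-cardinality (s≤s z≤n)
    (subst (λ k → HasCardinality (StartOfSize d₁ d₂ s) (2 * k + 1)) (⊓-∸-formula d₁ d₂ s)
      (starts-cardinality d₁ d₂ s s≤))

  point-cardinality-0 : ∀ s → s > d₁ + d₂ → HasCardinality (λ p → IsLargest (PointRep d₁ d₂ p) s) 0
  point-cardinality-0 s s> = [] , [] , refl , λ p → mk⇔ (λ ())
    (λ { (rep , _) → contradiction (PointRep-size rep) (ℕₚ.<⇒≱ s>) })

-- Transfer to ℤ[γ]

γ^- : ∀ j → γ^ (ℤ.- + j) ≡ val j ⊕ val (suc j) γ⁻¹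
γ^- zero          = refl
γ^- (suc zero)    = refl
-- Multiplication by γ⁻¹ sends the coordinates `m`, `n` to `n`, `m - n`, which is the recurrence of
-- `val`.
γ^- (suc (suc j)) = trans (cong (γ⁻¹ ℤ[γ]-Ops.*_) (γ^- (suc j)))
  (cong₂ _⊕_γ⁻¹ (lemma₁ (val (suc j)) (val (2 + j))) (lemma₂ (val (suc j)) (val (2 + j))))
  where
  lemma₁ : ∀ m n → + 0 ℤ.* m ℤ.+ + 1 ℤ.* n ≡ n
  lemma₁ = ℤ-Solver.solve-∀
  lemma₂ : ∀ m n → + 0 ℤ.* n ℤ.+ + 1 ℤ.* m ℤ.- + 1 ℤ.* n ≡ m ℤ.- n
  lemma₂ = ℤ-Solver.solve-∀

sum-γ^- : ∀ {s} (i : Vector ℤ s) → (∀ k → + 0 ℤ.≤ i k) → ℤ[γ]-Ops.sum (λ k → γ^ (ℤ.- i k)) ≡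
          ℤ-Ops.sum (λ k → f (ℤ.- i k)) ⊕ ℤ-Ops.sum (λ k → f (ℤ.- i k ℤ.- + 1)) γ⁻¹
sum-γ^- {zero}  i 0≤i = refl
sum-γ^- {suc s} i 0≤i with i Fin.zero | 0≤i Fin.zero | sum-γ^- (i ∘ Fin.suc) (0≤i ∘ Fin.suc)
... | + j | _ | e = cong₂ ℤ[γ]-Ops._+_
  (trans (γ^- j) (sym (cong₂ _⊕_γ⁻¹ (f-neg j) (f-neg-1 j)))) e

module _ (d₁ d₂ : ℕ) where

  γRep⇒PointRep : ∀ {m n s} → γRep d₁ d₂ (m ⊕ n γ⁻¹) s → PointRep d₁ d₂ (m , n) s
  γRep⇒PointRep (i , e , adm) with trans e (sum-γ^- i (Admissible.nonNegative adm))
  ... | refl = i , refl , adm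

  PointRep⇒γRep : ∀ {m n s} → PointRep d₁ d₂ (m , n) s → γRep d₁ d₂ (m ⊕ n γ⁻¹) s
  PointRep⇒γRep (i , refl , adm) = i , sym (sum-γ^- i (Admissible.nonNegative adm)) , adm

  γ-cardinality : ∀ {s k} → HasCardinality (λ p → IsLargest (PointRep d₁ d₂ p) s) k →
                  HasCardinality (λ α → E d₁ d₂ α × s[ d₁ , d₂ ] α is s) k
  γ-cardinality {s} = HasCardinality-image (λ (m , n) α → α ≡ m ⊕ n γ⁻¹)
    (λ {(m , n)} _ → m ⊕ n γ⁻¹ , refl)
    (λ { _ _ refl refl → refl })
    (λ { (rep , max) refl → (s , PointRep⇒γRep rep) , PointRep⇒γRep rep , λ t r → max t (γRep⇒PointRep r) })
    (λ { {m ⊕ n γ⁻¹} (_ , rep , max) →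
         (m , n) , (γRep⇒PointRep rep , λ t r → max t (PointRep⇒γRep r)) , refl })
    (λ { _ refl refl → refl })

mainTheorem2 : (d₁ d₂ s : ℕ) →
    ( (s ≤ d₁ + d₂ → HasCardinality (λ (p : ℤ × ℤ) → IsLargest (PointRep d₁ d₂ p) s) (2 * (d₁ ⊓ d₂ ⊓ s ⊓ (d₁ + d₂ ∸ s)) + 1))
    × (s > d₁ + d₂ → HasCardinality (λ (p : ℤ × ℤ) → IsLargest (PointRep d₁ d₂ p) s) 0) )
    ×
    ( (s ≤ d₁ + d₂ → HasCardinality (λ (α : ℤ[γ]) → E d₁ d₂ α × s[ d₁ , d₂ ] α is s) (2 * (d₁ ⊓ d₂ ⊓ s ⊓ (d₁ + d₂ ∸ s)) + 1))
    × (s > d₁ + d₂ → HasCardinality (λ (α : ℤ[γ]) → E d₁ d₂ α × s[ d₁ , d₂ ] α is s) 0) )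
mainTheorem2 d₁ d₂ s =
  (point-cardinality d₁ d₂ s , point-cardinality-0 d₁ d₂ s) ,
  (γ-cardinality d₁ d₂ ∘ point-cardinality d₁ d₂ s , γ-cardinality d₁ d₂ ∘ point-cardinality-0 d₁ d₂ s)
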